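{- Let $G$ be an essentially 4-connected toroidal triangulation with angle map $A(G)$, and let $D$ be a balanced 4-orientation of $A(G)$. An orientation $D'$ of $A(G)$ is a balanced 4-orientation if and only if $D$ and $D'$ are homologous (i.e. $D\setminus D'$ is $0$-homologous).
   Context: A toroidal map is a finite graph embedded on the (oriented) torus such that all faces are homeomorphic to open disks. Loops and multiple edges are allowed, but throughout embedded graphs have no contractible loop (an edge enclosing a region homeomorphic to an open disk) and no homotopic multiple edges (two edges with the same extremities whose union encloses a region homeomorphic to an open disk). A toroidal triangulation is a toroidal map all of whose faces have size three. A cycle is a closed walk with no repeated vertices (a loop is a cycle of length one); it is contractible if it encloses a region homeomorphic to an open disk. $G$ is essentially 4-connected if its universal cover is 4-connected (at least 5 vertices, connected after removal of any 3 vertices). The angle map $A(G)$ is the bipartite toroidal map whose vertices are the vertices of $G$ (primal-vertices) and one vertex inside each face of $G$ (dual-vertices), with one edge for each angle (corner) of $G$, joining the vertex of the angle to the dual-vertex of the face containing the angle. A 4-orientation of $A(G)$ is an orientation of its edges in which every primal-vertex has outdegree exactly 4 and every dual-vertex has outdegree exactly 1. Given an orientation of $A(G)$ and a cycle $C$ of $G$ with a direction of traversal, $\gamma(C)$ is the number of edges of $A(G)$ leaving $C$ (outgoing from vertices of $C$) on its right minus the number of edges of $A(G)$ leaving $C$ on its left. A 4-orientation is balanced if every non-contractible cycle $C$ of $G$ satisfies $\gamma(C)=0$. Fix an arbitrary reference orientation of the edges of $A(G)$. An oriented subgraph $T$ of $A(G)$ has characteristic flow $\phi(T)\in\mathbb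 Z^{E(A(G))}$ with coordinate $+1$ on an edge of $T$ directed as in the reference orientation, $-1$ on an edge of $T$ directed oppositely, and $0$ elsewhere; the characteristic flow of a walk counts forward minus backward traversals of each edge. $T$ is $0$-homologous if $\phi(T)$ belongs to the subgroup of $\mathbb Z^{E(A(G))}$ generated by the characteristic flows of the counterclockwise facial walks of $A(G)$. For orientations $D,D'$ of $A(G)$, $D\setminus D'$ is the oriented subgraph of $D$ induced by the edges that are not oriented as in $D'$. -}

module Defs where

open import Level using (0ℓ)
open import Function.Base using (_∘_; _on_)
open import Function.Bundles using (_↔_; _⇔_; Inverse; Equivalence; mk↔ₛ′; mk⇔)
open import Function.Definitions using (StrictlySurjective)
open import Data.Bool.Base using (Bool; true; false; not; if_then_else_)
import Data.Bool.Properties as Bool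
open import Data.Fin.Base using (Fin)
import Data.Fin.Properties as Fin
open import Data.Fin.Subset using (Subset; _∈_; _∉_; ∣_∣)
open import Data.Integer.Base using (ℤ; +_; 0ℤ; 1ℤ; -1ℤ) renaming (_+_ to _+ℤ_; -_ to -ℤ_; _-_ to _-ℤ_)
open import Data.List.Base using (List; []; _∷_; _++_; _∷ʳ_; map; foldr; filter; filterᵇ; length; zip; iterate; allFin; cartesianProduct)
open import Data.List.Relation.Unary.Unique.Propositional using (Unique)
import Data.List.Membership.Propositional as List
open import Data.Maybe.Base using (Maybe; just; nothing; maybe)
open import Data.Nat.Base using (ℕ; zero; suc; _+_; _<_)
open import Data.Nat.GeneralisedArithmetic using (fold; fold-+)
open import Data.Product.Base using (Σ; ∃; ∃-syntax; _×_; _,_; proj₁; proj₂)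
open import Data.Product.Properties using () renaming (≡-dec to ×-≡-dec)
open import Data.Sum.Base using (_⊎_; inj₁; inj₂)
open import Data.Sum.Properties using (inj₁-injective; inj₂-injective) renaming (≡-dec to ⊎-≡-dec)
open import Relation.Binary.Bundles using (Setoid)
open import Relation.Binary.Construct.Closure.Equivalence using (setoid)
open import Relation.Binary.Construct.Closure.ReflexiveTransitive using (Star)
open import Relation.Binary.Definitions using (DecidableEquality)
open import Relation.Binary.PropositionalEquality using (_≡_; _≢_; _≗_; refl; sym; trans; cong)
open import Relation.Nullary using (¬_; Dec; does)
open import Relation.Unary using (Pred)

private
  variable
    v e f : ℕ
    A V E F : Set

------------------------------------------------------------------------
-- Maps on oriented surfaces

SameOrbit : (A → A) → A → A → Set
SameOrbit g x y = ∃[ k ] fold x g k ≡ y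

reverse : E × Bool → E × Bool
reverse (x , b) = x , not b

-- A cellularly embedded graph without isolated vertices, given by its
-- rotation system.  Each edge x carries the two opposite darts (x , true)
-- and (x , false); σ sends a dart to the next one counterclockwise around
-- its source; φ then follows the boundary of the face on the left of a dart,
-- so that this face is seen counterclockwise.  All faces are open disks,
-- since they are the disks glued along the orbits of φ.
record Map (V E F : Set) : Set where
  Dart : Set
  Dart = E × Bool

  edge : Dart → E
  edge = proj₁

  field
    σ : Dart ↔ Dart

  σ⁺ : Dart → Dart
  σ⁺ = Inverse.to σ

  σ⁻ : Dart → Dart
  σ⁻ = Inverse.from σ

  φ : Dart → Dart
  φ = σ⁻ ∘ reverse

  field
    src         : Dart → V
    left        : Dart → F
    src-onto    : StrictlySurjective _≡_ src
    left-onto   : StrictlySurjective _≡_ left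
    src-orbits  : ∀ x y → src x ≡ src y ⇔ SameOrbit σ⁺ x y
    left-orbits : ∀ x y → left x ≡ left y ⇔ SameOrbit φ x y

  tgt : Dart → V
  tgt = src ∘ reverse

  Walk : V → List Dart → V → Set
  Walk u []       w = u ≡ w
  Walk u (d ∷ ds) w = src d ≡ u × Walk (tgt d) ds w

module _ (M : Map V E F) where
  open Map M

  data FacialWalk : List Dart → Set where
    once-around : ∀ d k → fold d φ (suc k) ≡ d → Unique (iterate φ d (suc k)) →
                  FacialWalk (iterate φ d (suc k))

FiniteMap : ℕ → ℕ → ℕ → Set
FiniteMap v e f = Map (Fin v) (Fin e) (Fin f)

darts : ∀ e → List (Fin e × Bool)
darts e = cartesianProduct (allFin e) (true ∷ false ∷ [])

dart-≟ : DecidableEquality (Fin e × Bool)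
dart-≟ = ×-≡-dec Fin._≟_ Bool._≟_

------------------------------------------------------------------------
-- Graphs and 4-connectivity

record Graph : Set₁ where
  field
    vertices : Setoid 0ℓ 0ℓ
  open Setoid vertices public using (_≈_) renaming (Carrier to Vertex)
  field
    _~_ : Vertex → Vertex → Set

module _ (Γ : Graph) where
  open Graph Γ

  Avoids : ∀ {n} → (Fin n → Vertex) → Vertex → Set
  Avoids S x = ∀ i → ¬ (x ≈ S i)

  StepAvoiding : ∀ {n} → (Fin n → Vertex) → Vertex → Vertex → Set
  StepAvoiding S x y = Avoids S y × (x ≈ y ⊎ x ~ y)

  DistinctVertices : ∀ {n} → (Fin n → Vertex) → Set
  DistinctVertices S = ∀ i j → S i ≈ S j → i ≡ j

  record FourConnected : Set where
    field
      five-vertices : ∃[ S ] DistinctVertices {5} S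
      connected     : ∀ (S : Fin 3 → Vertex) → DistinctVertices S →
                      ∀ x y → Avoids S x → Avoids S y →
                      Star (StepAvoiding S) x y

module _ (M : Map V E F) where
  open Map M

  -- Removal of a spur or of the full boundary of a face: these moves generate
  -- homotopy of walks with fixed extremities.
  data Move : List Dart → List Dart → Set where
    spur : ∀ xs d ys → Move (xs ++ d ∷ reverse d ∷ ys) (xs ++ ys)
    face : ∀ xs {ws} ys → FacialWalk M ws → Move (xs ++ ws ++ ys) (xs ++ ys)

  record WalkFrom (base : V) : Set where
    field
      end    : V
      steps  : List Dart
      isWalk : Walk base steps end
  open WalkFrom

  -- The vertices of the universal cover are the homotopy classes of walks
  -- starting at a base vertex; its edges extend a walk by one dart.
  universalCover : V → Graph
  universalCover base = record
    { vertices = classes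
    ; _~_      = λ x y → ∃[ d ] ∃[ z ] steps z ≡ steps x ∷ʳ d × z ≈ y
    }
    where
    classes : Setoid 0ℓ 0ℓ
    classes = setoid {A = WalkFrom base} (Move on steps)
    open Setoid classes using (_≈_)

  EssentiallyFourConnected : Set
  EssentiallyFourConnected = ∀ base → FourConnected (universalCover base)

------------------------------------------------------------------------
-- Toroidal triangulations

module _ (G : FiniteMap v e f) where
  open Map G

  -- The edges in B enclose a region homeomorphic to an open disk.  The region
  -- is a union of open cells, and every edge of B has it on exactly one side.
  -- A connected open surface of this kind is an open disk exactly when
  -- the alternating count of its cells is 1.
  record BoundsOpenDisk (B : Pred (Fin e) 0ℓ) : Set where
    field
      verts : Subset v
      edges : Subset e
      faces : Subset f
      boundary      : ∀ d → B (edge d) → left d ∈ faces ⇔ left (reverse d) ∉ faces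
      interior-edge : ∀ d → edge d ∈ edges ⇔ (¬ B (edge d) × left d ∈ faces)
      interior-vert : ∀ x → x ∈ verts ⇔ (∀ d → src d ≡ x → edge d ∈ edges)

    Adjacent : Fin f → Fin f → Set
    Adjacent g h = ∃[ d ] edge d ∈ edges × left d ≡ g × left (reverse d) ≡ h

    field
      connected : ∀ {g h} → g ∈ faces → h ∈ faces → Star Adjacent g h
      euler     : ∣ verts ∣ + ∣ faces ∣ ≡ ∣ edges ∣ + 1

  faceSize : Fin f → ℕ
  faceSize g = length (filter (λ d → left d Fin.≟ g) (darts e))

  record ToroidalTriangulation : Set where
    field
      nonempty  : 0 < v
      connected : ∀ u w → ∃[ ds ] Walk u ds w
      euler     : v + f ≡ e    -- genus 1
      no-contractible-loop : ∀ d → src d ≡ tgt d → ¬ BoundsOpenDisk (_≡ edge d)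
      no-homotopic-edges   : ∀ d d′ → edge d ≢ edge d′ →
                             src d ≡ src d′ → tgt d ≡ tgt d′ →
                             ¬ BoundsOpenDisk (λ x → x ≡ edge d ⊎ x ≡ edge d′)
      triangular : ∀ g → faceSize g ≡ 3

  -- Distinctness of edges only excludes going along an edge and straight back.
  record Cycle : Set where
    field
      first : Dart
      rest  : List Dart

    steps : List Dart
    steps = first ∷ rest

    field
      closed         : Walk (src first) steps (src first)
      vertices-once  : Unique (map src steps)
      edges-once     : Unique (map edge steps)

    passages : List (Dart × Dart)
    passages = zip steps (rest ∷ʳ first)

  Contractible : Cycle → Set
  Contractible C = BoundsOpenDisk (List._∈ map edge (Cycle.steps C))

------------------------------------------------------------------------
-- The angle map

-- An angle is named by the dart c on its clockwise side: it lies between c and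
-- σ⁺ c, inside the face on the left of c.  It gives an edge of the angle map
-- with darts (c , true), from the primal-vertex to the dual-vertex, and
-- (c , false).  The faces of the angle map correspond to the edges of G.
module _ (M : Map V E F) where
  open Map M

  private
    ADart : Set
    ADart = (E × Bool) × Bool

    reverse² : (d : E × Bool) → reverse (reverse d) ≡ d
    reverse² (x , b) = cong (x ,_) (Bool.not-involutive b)

    σσ⁻ : ∀ d → σ⁺ (σ⁻ d) ≡ d
    σσ⁻ = Inverse.strictlyInverseˡ σ

    σ⁻σ : ∀ d → σ⁻ (σ⁺ d) ≡ d
    σ⁻σ = Inverse.strictlyInverseʳ σ

    rot rot⁻ ψ : ADart → ADart
    rot  (c , true)  = σ⁺ c , true
    rot  (c , false) = φ c , false
    rot⁻ (c , true)  = σ⁻ c , true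
    rot⁻ (c , false) = reverse (σ⁺ c) , false
    ψ = rot⁻ ∘ reverse

    rot-rot⁻ : ∀ d → rot (rot⁻ d) ≡ d
    rot-rot⁻ (c , true)  = cong (_, true) (σσ⁻ c)
    rot-rot⁻ (c , false) = cong (_, false) (trans (cong σ⁻ (reverse² (σ⁺ c))) (σ⁻σ c))

    rot⁻-rot : ∀ d → rot⁻ (rot d) ≡ d
    rot⁻-rot (c , true)  = cong (_, true) (σ⁻σ c)
    rot⁻-rot (c , false) = cong (_, false) (trans (cong reverse (σσ⁻ (reverse c))) (reverse² c))

    source : ADart → V ⊎ F
    source (c , true)  = inj₁ (src c)
    source (c , false) = inj₂ (left c)

    around : ADart → E
    around (c , true)  = edge (σ⁺ c)
    around (c , false) = edge c

    constant : ∀ {X Y : Set} (h : X → Y) (g : X → X) → (∀ x → h (g x) ≡ h x) →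
               ∀ x k → h (fold x g k) ≡ h x
    constant h g inv x zero    = refl
    constant h g inv x (suc k) = trans (inv _) (constant h g inv x k)

    orbit-constant : ∀ {X Y : Set} (h : X → Y) (g : X → X) → (∀ x → h (g x) ≡ h x) →
                     ∀ x y → SameOrbit g x y → h x ≡ h y
    orbit-constant h g inv x _ (k , refl) = sym (constant h g inv x k)

    orbit-trans : ∀ {X : Set} (g : X → X) {x y z} →
                  SameOrbit g x y → SameOrbit g y z → SameOrbit g x z
    orbit-trans g {x} (m , refl) (n , refl) = n + m , fold-+ x g n

    fold-tag : ∀ (g : E × Bool → E × Bool) b → (∀ c → rot (c , b) ≡ (g c , b)) →
               ∀ c k → fold (c , b) rot k ≡ (fold c g k , b)
    fold-tag g b eq c zero    = refl
    fold-tag g b eq c (suc k) = trans (cong rot (fold-tag g b eq c k)) (eq _)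

    source-rot : ∀ d → source (rot d) ≡ source d
    source-rot (c , true)  = cong inj₁ (sym (Equivalence.from (src-orbits c (σ⁺ c)) (1 , refl)))
    source-rot (c , false) = cong inj₂ (sym (Equivalence.from (left-orbits c (φ c)) (1 , refl)))

    source-onto : StrictlySurjective _≡_ source
    source-onto (inj₁ x) = let d , p = src-onto x in (d , true) , cong inj₁ p
    source-onto (inj₂ g) = let d , p = left-onto g in (d , false) , cong inj₂ p

    source-orbit : ∀ x y → source x ≡ source y → SameOrbit rot x y
    source-orbit (c , true) (c′ , true) p with Equivalence.to (src-orbits c c′) (inj₁-injective p)
    ... | k , refl = k , fold-tag σ⁺ true (λ _ → refl) c k
    source-orbit (c , false) (c′ , false) p with Equivalence.to (left-orbits c c′) (inj₂-injective p)
    ... | k , refl = k , fold-tag φ false (λ _ → refl) c k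
    source-orbit (c , true) (c′ , false) ()
    source-orbit (c , false) (c′ , true) ()

    around-ψ : ∀ d → around (ψ d) ≡ around d
    around-ψ (c , true)  = refl
    around-ψ (c , false) = cong edge (σσ⁻ c)

    toDual : ∀ d → ∃[ b ] SameOrbit ψ d ((around d , b) , false)
    toDual (c , true)  = _ , 1 , refl
    toDual (c , false) = _ , 0 , refl

    fromDual : ∀ d → ∃[ b ] SameOrbit ψ ((around d , b) , false) d
    fromDual (c , true)  = _ , 1 , cong (_, true) (σ⁻σ c)
    fromDual (c , false) = _ , 0 , refl

    dualDual : ∀ x a b → SameOrbit ψ ((x , a) , false) ((x , b) , false)
    dualDual x true  true  = 0 , refl
    dualDual x false false = 0 , refl
    dualDual x true  false = 2 , cong (λ c → reverse c , false) (σσ⁻ (x , true))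
    dualDual x false true  = 2 , cong (λ c → reverse c , false) (σσ⁻ (x , false))

    around-orbit : ∀ x y → around x ≡ around y → SameOrbit ψ x y
    around-orbit x y p with around x | toDual x | around y | fromDual y | p
    ... | z | a , to | .z | b , from | refl =
      orbit-trans ψ to (orbit-trans ψ (dualDual z a b) from)

  angleMap : Map (V ⊎ F) (E × Bool) E
  angleMap = record
    { σ           = mk↔ₛ′ rot rot⁻ rot-rot⁻ rot⁻-rot
    ; src         = source
    ; left        = around
    ; src-onto    = source-onto
    ; left-onto   = λ x → ((x , true) , false) , refl
    ; src-orbits  = λ x y → mk⇔ (source-orbit x y) (orbit-constant source rot source-rot x y)
    ; left-orbits = λ x y → mk⇔ (around-orbit x y) (orbit-constant around ψ around-ψ x y)
    }

------------------------------------------------------------------------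
-- Orientations and homology

-- An orientation selects the dart (x , O x) of each edge x.
Orientation : Set → Set
Orientation E = E → Bool

OrientedSubgraph : Set → Set
OrientedSubgraph E = E → Maybe Bool

_∖_ : Orientation E → Orientation E → OrientedSubgraph E
(D ∖ D′) x = if does (D x Bool.≟ D′ x) then nothing else just (D x)

data Subgroup (Gen : Pred (A → ℤ) 0ℓ) : Pred (A → ℤ) 0ℓ where
  generator : ∀ {g} → Gen g → Subgroup Gen g
  zero      : Subgroup Gen (λ _ → 0ℤ)
  add       : ∀ {g h} → Subgroup Gen g → Subgroup Gen h → Subgroup Gen (λ x → g x +ℤ h x)
  negate    : ∀ {g} → Subgroup Gen g → Subgroup Gen (λ x → -ℤ g x)
  respects  : ∀ {g h} → g ≗ h → Subgroup Gen g → Subgroup Gen h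

module Homology (M : Map V E F) (_≟_ : DecidableEquality E) (R : Orientation E) where
  open Map M

  sign : Dart → ℤ
  sign (x , b) = if does (b Bool.≟ R x) then 1ℤ else -1ℤ

  flow : OrientedSubgraph E → E → ℤ
  flow T x = maybe (λ b → sign (x , b)) 0ℤ (T x)

  walkFlow : List Dart → E → ℤ
  walkFlow ds x = foldr _+ℤ_ 0ℤ (map sign (filter (λ d → edge d ≟ x) ds))

  data FacialFlow : Pred (E → ℤ) 0ℓ where
    facial : ∀ {ds} → FacialWalk M ds → FacialFlow (walkFlow ds)

  ZeroHomologous : OrientedSubgraph E → Set
  ZeroHomologous T = Subgroup FacialFlow (flow T)

  Homologous : Orientation E → Orientation E → Set
  Homologous D D′ = ZeroHomologous (D ∖ D′)

------------------------------------------------------------------------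
-- Balanced 4-orientations of the angle map

AngleOrientation : ℕ → Set
AngleOrientation e = Orientation (Fin e × Bool)

module _ (G : FiniteMap v e f) where
  open Map G

  tail : AngleOrientation e → Dart → Fin v ⊎ Fin f
  tail O c = Map.src (angleMap G) (c , O c)

  outdegree : AngleOrientation e → Fin v ⊎ Fin f → ℕ
  outdegree O x = length (filter (λ c → ⊎-≡-dec Fin._≟_ Fin._≟_ (tail O c) x) (darts e))

  Is4Orientation : AngleOrientation e → Set
  Is4Orientation O = (∀ x → outdegree O (inj₁ x) ≡ 4) × (∀ g → outdegree O (inj₂ g) ≡ 1)

  turn : ℕ → Dart → Dart → List Dart
  turn zero       a b = []
  turn (suc fuel) a b = if does (dart-≟ a b) then [] else a ∷ turn fuel (σ⁺ a) b

  -- The angles met when turning counterclockwise from dart a to dart b around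
  -- their common source; the number of darts is enough fuel to get there.
  angles : Dart → Dart → List Dart
  angles = turn (length (darts e))

  -- Edges of the angle map directed from the primal-vertex to the dual-vertex.
  leaving : AngleOrientation e → List Dart → ℤ
  leaving O cs = + length (filterᵇ O cs)

  -- Arriving by d and continuing by d′, the angles on the right are those from
  -- reverse d counterclockwise to d′.
  excess : AngleOrientation e → Dart × Dart → ℤ
  excess O (d , d′) = leaving O (angles (reverse d) d′) -ℤ leaving O (angles d′ (reverse d))

  γ : AngleOrientation e → Cycle G → ℤ
  γ O C = foldr _+ℤ_ 0ℤ (map (excess O) (Cycle.passages C))

  Balanced : AngleOrientation e → Set
  Balanced O = ∀ C → ¬ Contractible G C → γ O C ≡ 0ℤ

  IsBalanced4Orientation : AngleOrientation e → Set
  IsBalanced4Orientation O = Is4Orientation O × Balanced O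

  module AngleHomology (R : AngleOrientation e) = Homology (angleMap G) dart-≟ R

{-# OPTIONS --safe #-}

-- Record D and D′ by the difference h = [D c] − [D′ c] on the angles c, with [O c] = 1
-- when O directs c from the primal-vertex to the dual-vertex and 0 otherwise.  The
-- quadrangle of A(G) around an edge x contributes to an angle c, which lies between the
-- edges of c and σ c, the coefficient [x = edge (σ c)] − [x = edge c].  Hence D and D′ are
-- homologous exactly when h c = m (edge (σ c)) − m (edge c) for some m on the edges of G,
-- and then outdegrees and γ agree because the corresponding sums telescope.
--
-- Conversely, equal outdegrees at the primal-vertices give h c = p (σ c) − p c with p
-- defined on darts, and γ(C) then changes by 2 Σ j(d) over the darts d of C, where
-- j d = p d − p (reverse d).  This sum vanishes on non-contractible cycles since D and D′
-- are balanced, and on contractible ones by summation by parts, since h sums to zero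
-- around each face of the enclosed region.  As closed walks decompose into cycles and
-- spurs, j is the coboundary of some P on the vertices, and m = p + P ∘ src is well
-- defined on edges.
module Submission where

open import Defs
open import Algebra.Bundles using (module AbelianGroup)
open import Data.Bool.Base using (Bool; true; false)
import Data.Bool.Properties as Bool
open import Data.Fin.Base using (Fin; toℕ; fromℕ<)
import Data.Fin.Properties as Fin
open import Data.Fin.Subset using () renaming (_∈_ to _∈ˢ_)
open import Data.Fin.Subset.Properties using () renaming (_∈?_ to _∈ˢ?_)
open import Data.Integer.Base using (ℤ; -[1+_]; 0ℤ; 1ℤ; -1ℤ; -_; _+_; _*_; _-_) renaming (+_ to pos)
import Data.Integer.Properties as ℤ
open import Data.Integer.Tactic.RingSolver using (solve-∀)
open import Data.List.Base
  using (List; []; _∷_; _++_; _∷ʳ_; map; foldr; filter; filterᵇ; length; lookup; zip; allFin; iterate)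
import Data.List.Membership.DecPropositional as DecMembership
open import Data.List.Membership.Propositional using (_∈_; _∉_; find)
open import Data.List.Membership.Propositional.Properties
  using (∈-map⁺; ∈-map⁻; ∈-++⁺ˡ; ∈-++⁺ʳ; ∈-cartesianProduct⁺; ∈-allFin; ∈-∃++)
import Data.List.Properties as List
open import Data.List.Relation.Unary.All using ([]; _∷_)
import Data.List.Relation.Unary.All as All
import Data.List.Relation.Unary.All.Properties as All
open import Data.List.Relation.Unary.Any using (here; there; index; any?)
open import Data.List.Relation.Unary.Any.Properties using (lookup-index)
open import Data.List.Relation.Unary.Unique.Propositional using (Unique; []; _∷_)
import Data.List.Relation.Unary.Unique.Propositional.Properties as Unique
open import Data.Nat.Base as ℕ using (ℕ; zero; suc; z≤n; s≤s)
open import Data.Nat.GeneralisedArithmetic using (fold; fold-+)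
open import Data.Nat.Induction using (<-rec)
import Data.Nat.Properties as ℕ
open import Data.Nat.Tactic.RingSolver using () renaming (solve-∀ to solveℕ-∀)
open import Data.Product.Base using (∃-syntax; _×_; _,_; proj₁; proj₂)
open import Data.Sum.Base using (_⊎_; inj₁; inj₂)
open import Data.Sum.Properties using (inj₁-injective; inj₂-injective) renaming (≡-dec to ⊎-≡-dec)
open import Function.Base using (_∘_)
open import Function.Bundles using (Equivalence; Inverse; _⇔_; mk⇔)
open import Level using (0ℓ)
open import Relation.Binary.Definitions using (DecidableEquality)
open import Relation.Binary.PropositionalEquality
  using (_≡_; _≢_; refl; sym; trans; cong; cong₂; subst; module ≡-Reasoning)
open import Relation.Nullary using (¬_; Dec; does; yes; no; contradiction)
open import Relation.Nullary.Decidable using (does-⇔; dec-true; dec-false)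
open import Relation.Unary using (Decidable; Pred)
open import Algebra.Properties.Group (AbelianGroup.group ℤ.+-0-abelianGroup)
  using () renaming (∙-cancelʳ to +-cancelʳ)
open ≡-Reasoning

private
  variable
    v e f : ℕ
    A B : Set

-- Finite sums of integers

𝟙 : Bool → ℤ
𝟙 true  = 1ℤ
𝟙 false = 0ℤ

𝟙-true : {P : Set} (P? : Dec P) → P → 𝟙 (does P?) ≡ 1ℤ
𝟙-true P? p = cong 𝟙 (dec-true P? p)

𝟙-false : {P : Set} (P? : Dec P) → ¬ P → 𝟙 (does P?) ≡ 0ℤ
𝟙-false P? ¬p = cong 𝟙 (dec-false P? ¬p)

𝟙-cong : {P Q : Set} (P? : Dec P) (Q? : Dec Q) → (P → Q) → (Q → P) → 𝟙 (does P?) ≡ 𝟙 (does Q?)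
𝟙-cong P? Q? to from = cong 𝟙 (does-⇔ (mk⇔ to from) P? Q?)

∑ : List A → (A → ℤ) → ℤ
∑ xs f = foldr _+_ 0ℤ (map f xs)

∑-cong-∈ : ∀ {f g : A → ℤ} xs → (∀ {x} → x ∈ xs → f x ≡ g x) → ∑ xs f ≡ ∑ xs g
∑-cong-∈ []       eq = refl
∑-cong-∈ (x ∷ xs) eq = cong₂ _+_ (eq (here refl)) (∑-cong-∈ xs (eq ∘ there))

∑-cong : ∀ {f g : A → ℤ} xs → (∀ x → f x ≡ g x) → ∑ xs f ≡ ∑ xs g
∑-cong xs eq = ∑-cong-∈ xs (λ {x} _ → eq x)

∑-zero : ∀ {f : A → ℤ} xs → (∀ {x} → x ∈ xs → f x ≡ 0ℤ) → ∑ xs f ≡ 0ℤ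
∑-zero []       eq = refl
∑-zero (x ∷ xs) eq = cong₂ _+_ (eq (here refl)) (∑-zero xs (eq ∘ there))

∑-+ : ∀ (f g : A → ℤ) xs → ∑ xs (λ x → f x + g x) ≡ ∑ xs f + ∑ xs g
∑-+ f g []       = refl
∑-+ f g (x ∷ xs) = trans (cong ((f x + g x) +_) (∑-+ f g xs)) (interchange (f x) (g x) _ _)
  where
  interchange : ∀ a b c d → a + b + (c + d) ≡ a + c + (b + d)
  interchange = solve-∀

∑-* : ∀ k (f : A → ℤ) xs → ∑ xs (λ x → k * f x) ≡ k * ∑ xs f
∑-* k f []       = sym (ℤ.*-zeroʳ k)
∑-* k f (x ∷ xs) = trans (cong ((k * f x) +_) (∑-* k f xs)) (sym (ℤ.*-distribˡ-+ k (f x) _))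

∑-neg : ∀ (f : A → ℤ) xs → ∑ xs (λ x → - f x) ≡ - ∑ xs f
∑-neg f []       = refl
∑-neg f (x ∷ xs) = trans (cong ((- f x) +_) (∑-neg f xs)) (sym (ℤ.neg-distrib-+ (f x) _))

∑-- : ∀ (f g : A → ℤ) xs → ∑ xs (λ x → f x - g x) ≡ ∑ xs f - ∑ xs g
∑-- f g xs = trans (∑-+ f (-_ ∘ g) xs) (cong (∑ xs f +_) (∑-neg g xs))

∑-++ : ∀ (f : A → ℤ) xs ys → ∑ (xs ++ ys) f ≡ ∑ xs f + ∑ ys f
∑-++ f []       ys = sym (ℤ.+-identityˡ _)
∑-++ f (x ∷ xs) ys = trans (cong (f x +_) (∑-++ f xs ys)) (sym (ℤ.+-assoc (f x) _ _))

∑-map : ∀ (f : B → ℤ) (g : A → B) xs → ∑ (map g xs) f ≡ ∑ xs (f ∘ g)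
∑-map f g []       = refl
∑-map f g (x ∷ xs) = cong (f (g x) +_) (∑-map f g xs)

∑-swap : ∀ (f : A → B → ℤ) xs ys → ∑ xs (λ x → ∑ ys (f x)) ≡ ∑ ys (λ y → ∑ xs (λ x → f x y))
∑-swap f []       ys = sym (∑-zero ys (λ _ → refl))
∑-swap f (x ∷ xs) ys = trans (cong (∑ ys (f x) +_) (∑-swap f xs ys)) (sym (∑-+ (f x) _ ys))

length-filter : ∀ {P : A → Set} (P? : Decidable P) xs → pos (length (filter P? xs)) ≡ ∑ xs (𝟙 ∘ does ∘ P?)
length-filter P? []       = refl
length-filter P? (x ∷ xs) with does (P? x)
... | false = trans (length-filter P? xs) (sym (ℤ.+-identityˡ _))
... | true  = cong (1ℤ +_) (length-filter P? xs)

length-filterᵇ : ∀ (p : A → Bool) xs → pos (length (filterᵇ p xs)) ≡ ∑ xs (𝟙 ∘ p)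
length-filterᵇ p []       = refl
length-filterᵇ p (x ∷ xs) with p x
... | false = trans (length-filterᵇ p xs) (sym (ℤ.+-identityˡ _))
... | true  = cong (1ℤ +_) (length-filterᵇ p xs)

module _ (_≟_ : DecidableEquality A) where

  open DecMembership _≟_ using (_∈?_)

  ∑-pick : ∀ (f : A → ℤ) {xs a} → Unique xs → a ∈ xs → ∑ xs (λ x → 𝟙 (does (a ≟ x)) * f x) ≡ f a
  ∑-pick f {x ∷ xs} (x∉xs ∷ _) (here refl) = begin
    𝟙 (does (x ≟ x)) * f x + ∑ xs (λ y → 𝟙 (does (x ≟ y)) * f y)
      ≡⟨ cong₂ _+_ (cong (_* f x) (𝟙-true (x ≟ x) refl))
                   (∑-zero xs (λ {y} y∈xs → cong (_* f y) (𝟙-false (x ≟ y) (All.lookup x∉xs y∈xs)))) ⟩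
    1ℤ * f x + 0ℤ  ≡⟨ ℤ.+-identityʳ _ ⟩
    1ℤ * f x       ≡⟨ ℤ.*-identityˡ _ ⟩
    f x            ∎
  ∑-pick f {x ∷ xs} {a} (x∉xs ∷ xs!) (there a∈xs) = begin
    𝟙 (does (a ≟ x)) * f x + ∑ xs (λ y → 𝟙 (does (a ≟ y)) * f y)
      ≡⟨ cong₂ _+_ (cong (_* f x) (𝟙-false (a ≟ x) (λ a≡x → All.lookup x∉xs a∈xs (sym a≡x))))
          (∑-pick f xs! a∈xs) ⟩
    0ℤ * f x + f a  ≡⟨ ℤ.+-identityˡ _ ⟩
    f a             ∎

  -- Expanding `f x` by Kronecker deltas over `ys` and exchanging the two sums replaces any argument
  -- about reordering lists.
  ∑-support : ∀ (f : A → ℤ) {xs ys} → Unique xs → Unique ys → (∀ {x} → x ∈ ys → x ∈ xs) →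
              (∀ {x} → x ∈ xs → x ∉ ys → f x ≡ 0ℤ) → ∑ xs f ≡ ∑ ys f
  ∑-support f {xs} {ys} xs! ys! ys⊆xs vanish = begin
    ∑ xs f                                              ≡⟨ ∑-cong-∈ xs expand ⟩
    ∑ xs (λ x → ∑ ys (λ y → 𝟙 (does (y ≟ x)) * f x))  ≡⟨ ∑-swap _ xs ys ⟩
    ∑ ys (λ y → ∑ xs (λ x → 𝟙 (does (y ≟ x)) * f x))  ≡⟨ ∑-cong-∈ ys (λ y∈ys → ∑-pick f xs! (ys⊆xs y∈ys)) ⟩
    ∑ ys f                                              ∎
    where
    expand : ∀ {x} → x ∈ xs → f x ≡ ∑ ys (λ y → 𝟙 (does (y ≟ x)) * f x)
    expand {x} x∈xs with x ∈? ys
    ... | no  x∉ys = trans (vanish x∈xs x∉ys)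
        (sym (∑-zero ys (λ {y} _ →
        trans (cong (𝟙 (does (y ≟ x)) *_) (vanish x∈xs x∉ys)) (ℤ.*-zeroʳ (𝟙 (does (y ≟ x)))))))
    ... | yes x∈ys = sym (trans (∑-cong ys (λ y → cong (λ k → k * f x) (𝟙-cong (y ≟ x) (x ≟ y) sym sym)))
        (∑-pick (λ _ → f x) ys! x∈ys))

  ∑-permute : ∀ (f : A → ℤ) {xs} (π π⁻ : A → A) → (∀ x → π (π⁻ x) ≡ x) → (∀ x → π⁻ (π x) ≡ x) →
              Unique xs → (∀ x → x ∈ xs) → ∑ xs (f ∘ π) ≡ ∑ xs f
  ∑-permute f {xs} π π⁻ ππ⁻ π⁻π xs! all = trans (sym (∑-map f π xs))
    (sym (∑-support f xs! (Unique.map⁺ injective xs!) (λ _ → all _)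
      (λ {x} _ x∉ → contradiction (subst (_∈ map π xs) (ππ⁻ x) (∈-map⁺ π (all (π⁻ x)))) x∉)))
    where
    injective : ∀ {x y} → π x ≡ π y → x ≡ y
    injective {x} {y} eq = trans (sym (π⁻π x)) (trans (cong π⁻ eq) (π⁻π y))

*-distribˡ-- : ∀ a b c → a * (b - c) ≡ a * b - a * c
*-distribˡ-- = solve-∀

neg-- : ∀ a b → - (a - b) ≡ b - a
neg-- = solve-∀

-- Sums around vertices

reverse-involutive : (d : A × Bool) → reverse (reverse d) ≡ d
reverse-involutive (x , b) = cong (x ,_) (Bool.not-involutive b)

reverse-≢ : (d : A × Bool) → reverse d ≢ d
reverse-≢ (x , true)  ()
reverse-≢ (x , false) ()

darts! : ∀ e → Unique (darts e)
darts! e = Unique.cartesianProduct⁺ (Unique.allFin⁺ e) (((λ ()) ∷ []) ∷ [] ∷ [])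

∈-darts : (c : Fin e × Bool) → c ∈ darts e
∈-darts (x , true)  = ∈-cartesianProduct⁺ (∈-allFin x) (here refl)
∈-darts (x , false) = ∈-cartesianProduct⁺ (∈-allFin x) (there (here refl))

fold-comm : ∀ (g : A → A) a n → fold (g a) g n ≡ g (fold a g n)
fold-comm g a zero    = refl
fold-comm g a (suc n) = cong g (fold-comm g a n)

module _ (g : A → A) {xs : List A} (all : ∀ x → x ∈ xs) where

  private
    position : A → Fin (length xs)
    position x = index (all x)

    position-injective : ∀ {x y} → position x ≡ position y → x ≡ y
    position-injective {x} {y} eq =
      trans (lookup-index (all x)) (trans (cong (lookup xs) eq) (sym (lookup-index (all y))))

  -- By the pigeonhole principle two of the iterates numbered 0 to `length xs` coincide; the stretch
  -- between them can be cut out of the run to `b`.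
  orbit-shorten : ∀ {a b} k → length xs ℕ.< k → fold a g k ≡ b → ∃[ l ] l ℕ.< k × fold a g l ≡ b
  orbit-shorten {a} {b} k n<k eq
    with Fin.pigeonhole (ℕ.n<1+n (length xs)) (λ i → position (fold a g (toℕ i)))
  ... | i , j , i<j , same = k ℕ.∸ toℕ j ℕ.+ toℕ i , shorter , (begin
    fold a g (k ℕ.∸ toℕ j ℕ.+ toℕ i)            ≡⟨ fold-+ a g (k ℕ.∸ toℕ j) ⟩
    fold (fold a g (toℕ i)) g (k ℕ.∸ toℕ j)
        ≡⟨ cong (λ c → fold c g (k ℕ.∸ toℕ j)) (position-injective same) ⟩
    fold (fold a g (toℕ j)) g (k ℕ.∸ toℕ j)     ≡⟨ fold-+ a g (k ℕ.∸ toℕ j) ⟨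
    fold a g (k ℕ.∸ toℕ j ℕ.+ toℕ j)            ≡⟨ cong (fold a g) (ℕ.m∸n+n≡m j≤k) ⟩
    fold a g k                                  ≡⟨ eq ⟩
    b                                           ∎)
    where
    j≤k : toℕ j ℕ.≤ k
    j≤k = ℕ.≤-trans (ℕ.≤-pred (Fin.toℕ<n j)) (ℕ.<⇒≤ n<k)
    shorter : k ℕ.∸ toℕ j ℕ.+ toℕ i ℕ.< k
    shorter = subst (k ℕ.∸ toℕ j ℕ.+ toℕ i ℕ.<_) (ℕ.m∸n+n≡m j≤k) (ℕ.+-monoʳ-< (k ℕ.∸ toℕ j) i<j)

  -- `angles` runs `turn` with the number of darts as fuel; this bound shows that the fuel suffices.
  orbit-bounded : ∀ {a b} k → fold a g k ≡ b → ∃[ l ] l ℕ.≤ length xs × fold a g l ≡ b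
  orbit-bounded {a} {b} = <-rec (λ k → fold a g k ≡ b → ∃[ l ] l ℕ.≤ length xs × fold a g l ≡ b) step
    where
    step : ∀ k → (∀ {l} → l ℕ.< k → fold a g l ≡ b → ∃[ m ] m ℕ.≤ length xs × fold a g m ≡ b) →
           fold a g k ≡ b → ∃[ l ] l ℕ.≤ length xs × fold a g l ≡ b
    step k rec eq with k ℕ.≤? length xs
    ... | yes k≤n = k , k≤n , eq
    ... | no  k≰n = let l , l<k , eq′ = orbit-shorten k (ℕ.≰⇒> k≰n) eq in rec l<k eq′

module OnMap (G : FiniteMap v e f) where
  open Map G public

  δ : Dart → Dart → ℤ
  δ a c = 𝟙 (does (dart-≟ a c))

  ∂ : (Fin e → ℤ) → Dart → ℤ
  ∂ m c = m (edge (σ⁺ c)) - m (edge c)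

  σ⁺σ⁻ : ∀ c → σ⁺ (σ⁻ c) ≡ c
  σ⁺σ⁻ = Inverse.strictlyInverseˡ σ

  σ⁻σ⁺ : ∀ c → σ⁻ (σ⁺ c) ≡ c
  σ⁻σ⁺ = Inverse.strictlyInverseʳ σ

  src-σ⁺ : ∀ c → src (σ⁺ c) ≡ src c
  src-σ⁺ c = sym (Equivalence.from (src-orbits c (σ⁺ c)) (1 , refl))

  left-φ : ∀ c → left (φ c) ≡ left c
  left-φ c = sym (Equivalence.from (left-orbits c (φ c)) (1 , refl))

  left-σ⁻ : ∀ c → left (σ⁻ c) ≡ left (reverse c)
  left-σ⁻ c = trans (cong (left ∘ σ⁻) (sym (reverse-involutive c))) (left-φ (reverse c))

  σ⁺φ : ∀ c → σ⁺ (φ c) ≡ reverse c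
  σ⁺φ c = σ⁺σ⁻ (reverse c)

  ∑-σ⁺ : ∀ (g : Dart → ℤ) → ∑ (darts e) (g ∘ σ⁺) ≡ ∑ (darts e) g
  ∑-σ⁺ g = ∑-permute dart-≟ g σ⁺ σ⁻ σ⁺σ⁻ σ⁻σ⁺ (darts! e) ∈-darts

  ∑-φ : ∀ (g : Dart → ℤ) → ∑ (darts e) (g ∘ φ) ≡ ∑ (darts e) g
  ∑-φ g = ∑-permute dart-≟ g φ (reverse ∘ σ⁺)
    (λ c → trans (cong σ⁻ (reverse-involutive (σ⁺ c))) (σ⁻σ⁺ c))
    (λ c → trans (cong reverse (σ⁺φ c)) (reverse-involutive c)) (darts! e) ∈-darts

  ∑-darts-pick : ∀ (g : Dart → ℤ) a → ∑ (darts e) (λ c → δ a c * g c) ≡ g a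
  ∑-darts-pick g a = ∑-pick dart-≟ g (darts! e) (∈-darts a)

  ∑-at : (Dart → ℤ) → Fin v → ℤ
  ∑-at h x = ∑ (darts e) (λ c → 𝟙 (does (src c Fin.≟ x)) * h c)

  ∑-around : (Dart → ℤ) → Fin f → ℤ
  ∑-around h g = ∑ (darts e) (λ c → 𝟙 (does (left c Fin.≟ g)) * h c)

  partial : (Dart → ℤ) → Dart → ℕ → ℤ
  partial h r zero    = 0ℤ
  partial h r (suc n) = partial h r n + h (fold r σ⁺ n)

  partial-cong : ∀ {g h : Dart → ℤ} → (∀ c → g c ≡ h c) → ∀ r n → partial g r n ≡ partial h r n
  partial-cong eq r zero    = refl
  partial-cong eq r (suc n) = cong₂ _+_ (partial-cong eq r n) (eq _)

  -- Both sides add `h` over the iterates numbered 0 to `n`.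
  partial-shift : ∀ h r n → partial (h ∘ σ⁺) r n + h r ≡ partial h r n + h (fold r σ⁺ n)
  partial-shift h r zero    = refl
  partial-shift h r (suc n) = trans (swap (partial (h ∘ σ⁺) r n) (h (fold r σ⁺ (suc n))) (h r))
      (cong (_+ h (fold r σ⁺ (suc n))) (partial-shift h r n))
    where
    swap : ∀ a b c → a + b + c ≡ a + c + b
    swap = solve-∀

  partial-+ : ∀ h r m n → partial h r (m ℕ.+ n) ≡ partial h r n + partial h (fold r σ⁺ n) m
  partial-+ h r zero    n = sym (ℤ.+-identityʳ _)
  partial-+ h r (suc m) n =
    trans (cong₂ _+_ (partial-+ h r m n) (cong h (fold-+ r σ⁺ m))) (ℤ.+-assoc (partial h r n) _ _)

  visits : Dart → ℕ → Dart → ℤ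
  visits r n c = partial (λ d → δ d c) r n

  -- Regrouping a run by darts makes it comparable with `∑-at`, however many turns it makes.
  partial-visits : ∀ h r n → partial h r n ≡ ∑ (darts e) (λ c → visits r n c * h c)
  partial-visits h r zero    = sym (∑-zero (darts e) (λ _ → refl))
  partial-visits h r (suc n) = begin
    partial h r n + h d
      ≡⟨ cong₂ _+_ (partial-visits h r n) (sym (∑-darts-pick h d)) ⟩
    ∑ (darts e) (λ c → visits r n c * h c) + ∑ (darts e) (λ c → δ d c * h c)
      ≡⟨ ∑-+ _ _ (darts e) ⟨
    ∑ (darts e) (λ c → visits r n c * h c + δ d c * h c)
      ≡⟨ ∑-cong (darts e) (λ c → sym (ℤ.*-distribʳ-+ (h c) (visits r n c) _)) ⟩
    ∑ (darts e) (λ c → visits r (suc n) c * h c) ∎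
    where
    d : Dart
    d = fold r σ⁺ n

  src-fold : ∀ r n → src (fold r σ⁺ n) ≡ src r
  src-fold r n = sym (Equivalence.from (src-orbits r (fold r σ⁺ n)) (n , refl))

  visits-off : ∀ {r c} n → src c ≢ src r → visits r n c ≡ 0ℤ
  visits-off     zero    _ = refl
  visits-off {r} {c} (suc n) ne = cong₂ _+_ (visits-off n ne)
    (𝟙-false (dart-≟ (fold r σ⁺ n) c) (λ eq → ne (trans (cong src (sym eq)) (src-fold r n))))

  -- Shifting a closed run by one step only exchanges its two equal ends. The term `δ r (σ⁺ c)` is
  -- added so that `partial-shift` applies, and is then cancelled.
  visits-σ⁺ : ∀ {r} n → fold r σ⁺ n ≡ r → ∀ c → visits r n (σ⁺ c) ≡ visits r n c
  visits-σ⁺ {r} n closed c = sym (+-cancelʳ (δ r (σ⁺ c)) _ _ (begin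
    partial (λ d → δ d c) r n + δ r (σ⁺ c)
      ≡⟨ cong (_+ δ r (σ⁺ c)) (partial-cong (λ d → 𝟙-cong (dart-≟ d c) (dart-≟ (σ⁺ d) (σ⁺ c)) (cong σ⁺)
           (λ eq → trans (sym (σ⁻σ⁺ d)) (trans (cong σ⁻ eq) (σ⁻σ⁺ c)))) r n) ⟩
    partial ((λ d → δ d (σ⁺ c)) ∘ σ⁺) r n + δ r (σ⁺ c)
      ≡⟨ partial-shift (λ d → δ d (σ⁺ c)) r n ⟩
    partial (λ d → δ d (σ⁺ c)) r n + δ (fold r σ⁺ n) (σ⁺ c)
      ≡⟨ cong (λ d → partial (λ d → δ d (σ⁺ c)) r n + δ d (σ⁺ c)) closed ⟩
    partial (λ d → δ d (σ⁺ c)) r n + δ r (σ⁺ c) ∎))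

  visits-fold : ∀ {r} n → fold r σ⁺ n ≡ r → ∀ k → visits r n (fold r σ⁺ k) ≡ visits r n r
  visits-fold n closed zero    = refl
  visits-fold n closed (suc k) = trans (visits-σ⁺ n closed _) (visits-fold n closed k)

  -- A closed run of σ may go around the vertex several times; counting its visits
  -- to each dart avoids any discussion of minimal periods.
  visits-closed : ∀ {r} n → fold r σ⁺ n ≡ r → ∀ c →
                  visits r n c ≡ visits r n r * 𝟙 (does (src c Fin.≟ src r))
  visits-closed {r} n closed c with src c Fin.≟ src r
  ... | no  ne = trans (visits-off n ne) (sym (ℤ.*-zeroʳ (visits r n r)))
  ... | yes eq with Equivalence.to (src-orbits r c) (sym eq)
  ...   | k , refl = trans (visits-fold n closed k) (sym (ℤ.*-identityʳ _))

  module _ {h : Dart → ℤ} (balanced : ∀ x → ∑-at h x ≡ 0ℤ) where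

    -- By `visits-closed` all darts at the vertex are visited equally often, so the sum is a
    -- multiple of `∑-at h (src r)`.
    partial-closed : ∀ r n → fold r σ⁺ n ≡ r → partial h r n ≡ 0ℤ
    partial-closed r n closed = begin
      partial h r n
        ≡⟨ partial-visits h r n ⟩
      ∑ (darts e) (λ c → visits r n c * h c)
        ≡⟨ ∑-cong (darts e) (λ c → trans (cong (_* h c) (visits-closed n closed c))
            (ℤ.*-assoc (visits r n r) _ _)) ⟩
      ∑ (darts e) (λ c → visits r n r * (𝟙 (does (src c Fin.≟ src r)) * h c))
        ≡⟨ ∑-* (visits r n r) _ (darts e) ⟩
      visits r n r * ∑-at h (src r)
        ≡⟨ cong (visits r n r *_) (balanced (src r)) ⟩
      visits r n r * 0ℤ
        ≡⟨ ℤ.*-zeroʳ (visits r n r) ⟩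
      0ℤ ∎

    -- The longer run extends the shorter one by a closed run, whose sum vanishes. This is what
    -- makes `potential` well defined.
    partial-unique-≤ : ∀ r {m n} → m ℕ.≤ n → fold r σ⁺ m ≡ fold r σ⁺ n → partial h r m ≡ partial h r n
    partial-unique-≤ r {m} {n} m≤n eq = begin
      partial h r m
        ≡⟨ ℤ.+-identityʳ _ ⟨
      partial h r m + 0ℤ
        ≡⟨ cong (λ k → partial h r m + k) (partial-closed (fold r σ⁺ m) (n ℕ.∸ m) closed) ⟨
      partial h r m + partial h (fold r σ⁺ m) (n ℕ.∸ m)
        ≡⟨ partial-+ h r (n ℕ.∸ m) m ⟨
      partial h r (n ℕ.∸ m ℕ.+ m)
        ≡⟨ cong (partial h r) (ℕ.m∸n+n≡m m≤n) ⟩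
      partial h r n ∎
      where
      closed : fold (fold r σ⁺ m) σ⁺ (n ℕ.∸ m) ≡ fold r σ⁺ m
      closed = trans (sym (fold-+ r σ⁺ (n ℕ.∸ m))) (trans (cong (fold r σ⁺) (ℕ.m∸n+n≡m m≤n)) (sym eq))

    partial-unique : ∀ r m n → fold r σ⁺ m ≡ fold r σ⁺ n → partial h r m ≡ partial h r n
    partial-unique r m n eq with ℕ.≤-total m n
    ... | inj₁ m≤n = partial-unique-≤ r m≤n eq
    ... | inj₂ n≤m = sym (partial-unique-≤ r n≤m (sym eq))

    private
      rep : Fin v → Dart
      rep x = proj₁ (src-onto x)

      reached : ∀ c → SameOrbit σ⁺ (rep (src c)) c
      reached c = Equivalence.to (src-orbits (rep (src c)) c) (proj₂ (src-onto (src c)))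

    -- The run starts at a fixed dart of the vertex. Its length is whatever `src-orbits` yields;
    -- `partial-unique` makes that choice immaterial.
    potential : Dart → ℤ
    potential c = partial h (rep (src c)) (proj₁ (reached c))

    potential-σ⁺ : ∀ c → h c ≡ potential (σ⁺ c) - potential c
    potential-σ⁺ c = begin
      h c
        ≡⟨ cong h (proj₂ (reached c)) ⟨
      h (fold r σ⁺ k)
        ≡⟨ cancel (partial h r k) _ ⟩
      partial h r (suc k) - partial h r k
        -- From the same base dart, `suc k` steps and `l` steps both lead to `σ⁺ c`.
        ≡⟨ cong (_- potential c) (partial-unique r (suc k) l
             (trans (cong σ⁺ (proj₂ (reached c))) (sym σ⁺c-reached))) ⟩
      partial h r l - potential c
        ≡⟨ cong (λ x → partial h (rep x) l - potential c) (src-σ⁺ c) ⟨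
      potential (σ⁺ c) - potential c ∎
      where
      r : Dart
      r = rep (src c)
      k l : ℕ
      k = proj₁ (reached c)
      l = proj₁ (reached (σ⁺ c))
      σ⁺c-reached : fold r σ⁺ l ≡ σ⁺ c
      σ⁺c-reached = subst (λ x → fold (rep x) σ⁺ l ≡ σ⁺ c) (src-σ⁺ c) (proj₂ (reached (σ⁺ c)))
      cancel : ∀ a b → b ≡ a + b - a
      cancel = solve-∀

  module _ {h p : Dart → ℤ} (h-p : ∀ c → h c ≡ p (σ⁺ c) - p c) where

    -- The number `k` only witnesses that the fuel suffices: `turn` stops at the first arrival at
    -- `b`, possibly after fewer steps, and the sum telescopes all the same.
    ∑-turn : ∀ n k {a b} → k ℕ.≤ n → fold a σ⁺ k ≡ b → ∑ (turn G n a b) h ≡ p b - p a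
    ∑-turn zero    zero    {a} z≤n refl = sym (ℤ.+-inverseʳ (p a))
    ∑-turn (suc n) k {a} {b} k≤n eq with dart-≟ a b
    ... | yes refl = sym (ℤ.+-inverseʳ (p a))
    ∑-turn (suc n) zero    {a} k≤n eq | no a≢b = contradiction eq a≢b
    ∑-turn (suc n) (suc k) {a} {b} (s≤s k≤n) eq | no a≢b = begin
      h a + ∑ (turn G n (σ⁺ a) b) h       ≡⟨ cong₂ _+_ (h-p a) (∑-turn n k k≤n (trans (fold-comm σ⁺ a k) eq)) ⟩
      p (σ⁺ a) - p a + (p b - p (σ⁺ a))   ≡⟨ telescope (p (σ⁺ a)) (p a) (p b) ⟩
      p b - p a                           ∎
      where
      telescope : ∀ x y z → x - y + (z - x) ≡ z - y
      telescope = solve-∀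

    ∑-angles : ∀ {a b} → src a ≡ src b → ∑ (angles G a b) h ≡ p b - p a
    ∑-angles {a} {b} eq =
      let k , reached  = Equivalence.to (src-orbits a b) eq
          l , l≤n , eq = orbit-bounded σ⁺ ∈-darts k reached
      in ∑-turn (length (darts e)) l l≤n eq

  -- Change of `γ` between two orientations

  diff : AngleOrientation e → AngleOrientation e → Dart → ℤ
  diff D D′ c = 𝟙 (D c) - 𝟙 (D′ c)

  module _ {D D′ : AngleOrientation e} {p : Dart → ℤ} (diff-p : ∀ c → diff D D′ c ≡ p (σ⁺ c) - p c) where

    leaving-diff : ∀ {a b} → src a ≡ src b →
                   leaving G D (angles G a b) - leaving G D′ (angles G a b) ≡ p b - p a
    leaving-diff {a} {b} eq = begin
      leaving G D cs - leaving G D′ cs        ≡⟨ cong₂ _-_ (length-filterᵇ D cs) (length-filterᵇ D′ cs) ⟩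
      ∑ cs (𝟙 ∘ D) - ∑ cs (𝟙 ∘ D′)            ≡⟨ ∑-- (𝟙 ∘ D) (𝟙 ∘ D′) cs ⟨
      ∑ cs (diff D D′)                        ≡⟨ ∑-angles {p = p} diff-p eq ⟩
      p b - p a                               ∎
      where
      cs : List Dart
      cs = angles G a b

    -- The angles on the right contribute `p d′ - p (reverse d)` and those on the left its opposite;
    -- subtracting the latter gives a second copy, hence the factor 2.
    excess-diff : ∀ d d′ → tgt d ≡ src d′ →
                  excess G D (d , d′) - excess G D′ (d , d′) ≡ pos 2 * (p d′ - p (reverse d))
    excess-diff d d′ eq = trans
      (regroup (leaving G D (angles G (reverse d) d′)) (leaving G D (angles G d′ (reverse d)))
               (leaving G D′ (angles G (reverse d) d′)) (leaving G D′ (angles G d′ (reverse d)))) (trans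
      (cong₂ _-_ (leaving-diff eq) (leaving-diff (sym eq))) (double (p d′) _))
      where
      regroup : ∀ a b c d → a - b - (c - d) ≡ a - c - (b - d)
      regroup = solve-∀
      double : ∀ a b → a - b - (b - a) ≡ pos 2 * (a - b)
      double = solve-∀

    jump : Dart → ℤ
    jump d = p d - p (reverse d)

    -- Stated for open walks to allow induction. A passage pairs `d′` with the reverse of the
    -- preceding dart, while `jump` pairs a dart with its own reverse; this shift leaves the end
    -- term `p z - p d`, which vanishes when the walk closes up with `z` equal to `d`.
    ∑-passages : ∀ u d ds z → Walk u (d ∷ ds) (src z) →
                 ∑ (zip (d ∷ ds) (ds ∷ʳ z)) (excess G D) - ∑ (zip (d ∷ ds) (ds ∷ʳ z)) (excess G D′) ≡
                 pos 2 * (∑ (d ∷ ds) jump + (p z - p d))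
    ∑-passages u d [] z (_ , eq) = begin
      excess G D (d , z) + 0ℤ - (excess G D′ (d , z) + 0ℤ)
          ≡⟨ cong₂ _-_ (ℤ.+-identityʳ (excess G D (d , z)))
          (ℤ.+-identityʳ (excess G D′ (d , z))) ⟩
      excess G D (d , z) - excess G D′ (d , z)               ≡⟨ excess-diff d z eq ⟩
      pos 2 * (p z - p (reverse d))                          ≡⟨ regroup (p z) (p d) _ ⟩
      pos 2 * (jump d + 0ℤ + (p z - p d))                    ∎
      where
      regroup : ∀ a b c → pos 2 * (a - c) ≡ pos 2 * (b - c + 0ℤ + (a - b))
      regroup = solve-∀
    ∑-passages u d (d′ ∷ ds) z (_ , eq , walk) = begin
      excess G D (d , d′) + E - (excess G D′ (d , d′) + E′)
        ≡⟨ regroup₁ (excess G D (d , d′)) E (excess G D′ (d , d′)) E′ ⟩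
      excess G D (d , d′) - excess G D′ (d , d′) + (E - E′)
        ≡⟨ cong₂ _+_ (excess-diff d d′ (sym eq)) (∑-passages (src d′) d′ ds z (refl , walk)) ⟩
      pos 2 * (p d′ - p (reverse d)) + pos 2 * (∑ (d′ ∷ ds) jump + (p z - p d′))
        ≡⟨ regroup₂ (p d′) (p (reverse d)) (∑ (d′ ∷ ds) jump) (p z) (p d) ⟩
      pos 2 * (jump d + ∑ (d′ ∷ ds) jump + (p z - p d)) ∎
      where
      E E′ : ℤ
      E  = ∑ (zip (d′ ∷ ds) (ds ∷ʳ z)) (excess G D)
      E′ = ∑ (zip (d′ ∷ ds) (ds ∷ʳ z)) (excess G D′)
      regroup₁ : ∀ a b c d → a + b - (c + d) ≡ a - c + (b - d)
      regroup₁ = solve-∀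
      regroup₂ : ∀ a b s z d → pos 2 * (a - b) + pos 2 * (s + (z - a)) ≡ pos 2 * (d - b + s + (z - d))
      regroup₂ = solve-∀

    γ-diff : ∀ C → γ G D C - γ G D′ C ≡ pos 2 * ∑ (Cycle.steps C) jump
    γ-diff C = trans (∑-passages _ first rest first closed)
      (cong (pos 2 *_) (trans (cong (∑ (first ∷ rest) jump +_) (ℤ.+-inverseʳ (p first))) (ℤ.+-identityʳ _)))
      where open Cycle C

-- Homology in the angle map

∑-filter : ∀ {P : A → Set} (P? : Decidable P) (f : A → ℤ) xs →
           ∑ (filter P? xs) f ≡ ∑ xs (λ x → 𝟙 (does (P? x)) * f x)
∑-filter P? f []       = refl
∑-filter P? f (x ∷ xs) with does (P? x)
... | false = trans (∑-filter P? f xs) (sym (ℤ.+-identityˡ _))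
... | true  = cong₂ _+_ (sym (ℤ.*-identityˡ (f x))) (∑-filter P? f xs)

module _ {Gen : Pred (A → ℤ) 0ℓ} where

  Subgroup-multipleℕ : ∀ {g} n → Subgroup Gen g → Subgroup Gen (λ x → pos n * g x)
  Subgroup-multipleℕ zero    H = zero
  Subgroup-multipleℕ {g} (suc n) H =
    respects (λ x → sym (ℤ.suc-* (pos n) (g x))) (add H (Subgroup-multipleℕ n H))

  Subgroup-multiple : ∀ {g} k → Subgroup Gen g → Subgroup Gen (λ x → k * g x)
  Subgroup-multiple     (pos n)  H = Subgroup-multipleℕ n H
  Subgroup-multiple {g} -[1+ n ] H =
    respects (λ x → ℤ.neg-distribˡ-* (pos (suc n)) (g x)) (negate (Subgroup-multipleℕ (suc n) H))

  Subgroup-∑ : ∀ {g : B → A → ℤ} xs → (∀ y → Subgroup Gen (g y)) → Subgroup Gen (λ x → ∑ xs (λ y → g y x))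
  Subgroup-∑ []       H = zero
  Subgroup-∑ (y ∷ xs) H = add (H y) (Subgroup-∑ xs H)

module FacialFlows (G : FiniteMap v e f) (R : AngleOrientation e) where
  open OnMap G public
  open Homology (angleMap G) dart-≟ R public

  -- The reference sign of the angle directed from primal to dual. Every flow below is written as
  -- `ε c` times a quantity independent of `R`.
  ε : Dart → ℤ
  ε c = sign (c , true)

  ε² : ∀ c → ε c * ε c ≡ 1ℤ
  ε² c with R c
  ... | true  = refl
  ... | false = refl

  ε-cancel : ∀ c {a b} → ε c * a ≡ ε c * b → a ≡ b
  ε-cancel c {a} {b} eq = trans (twice a) (trans (cong (ε c *_) eq) (sym (twice b)))
    where
    twice : ∀ a → a ≡ ε c * (ε c * a)
    twice a = sym (trans (sym (ℤ.*-assoc (ε c) (ε c) a)) (trans (cong (_* a) (ε² c)) (ℤ.*-identityˡ a)))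

  flow-∖ : ∀ D D′ c → flow (D ∖ D′) c ≡ ε c * diff D D′ c
  flow-∖ D D′ c with D c | D′ c | R c
  ... | true  | true  | true  = refl
  ... | true  | true  | false = refl
  ... | true  | false | true  = refl
  ... | true  | false | false = refl
  ... | false | true  | true  = refl
  ... | false | true  | false = refl
  ... | false | false | true  = refl
  ... | false | false | false = refl

  direction : Bool → ℤ
  direction true  = 1ℤ
  direction false = -1ℤ

  sign-ε : ∀ c b → sign (c , b) ≡ ε c * direction b
  sign-ε c b with b | R c
  ... | true  | true  = refl
  ... | true  | false = refl
  ... | false | true  = refl
  ... | false | false = refl

  walkFlow-∑ : ∀ ds c → walkFlow ds c ≡ ε c * ∑ ds (λ (a , b) → direction b * δ a c)
  walkFlow-∑ ds c = begin
    walkFlow ds c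
      ≡⟨ ∑-filter (λ (a , _) → dart-≟ a c) sign ds ⟩
    ∑ ds (λ (a , b) → δ a c * sign (a , b))
      ≡⟨ ∑-cong ds term ⟩
    ∑ ds (λ (a , b) → ε c * (direction b * δ a c))
      ≡⟨ ∑-* (ε c) _ ds ⟩
    ε c * ∑ ds (λ (a , b) → direction b * δ a c) ∎
    where
    term : ∀ ((a , b) : Dart × Bool) →
           δ a c * sign (a , b) ≡ ε c * (direction b * δ a c)
    term (a , b) with dart-≟ a c
    ... | no  _    = sym (trans (cong (ε c *_) (ℤ.*-zeroʳ (direction b))) (ℤ.*-zeroʳ (ε c)))
    ... | yes refl = trans (ℤ.*-identityˡ _) (trans (sign-ε a b) (cong (ε a *_) (sym (ℤ.*-identityʳ _))))

  edge-𝟙 : ∀ d c → 𝟙 (does (edge d Fin.≟ edge c)) ≡ δ d c + δ (reverse d) c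
  edge-𝟙 d c = by-cases d c (edge d Fin.≟ edge c)
    where
    by-cases : ∀ d c → Dec (edge d ≡ edge c) →
               𝟙 (does (edge d Fin.≟ edge c)) ≡ δ d c + δ (reverse d) c
    by-cases d c (no x≢y) = trans (𝟙-false (edge d Fin.≟ edge c) x≢y) (sym (cong₂ _+_
      (𝟙-false (dart-≟ d c) (x≢y ∘ cong proj₁)) (𝟙-false (dart-≟ (reverse d) c) (x≢y ∘ cong proj₁))))
    by-cases d@(x , b) c@(x , b′) (yes refl) with b Bool.≟ b′
    ... | yes refl = trans (𝟙-true (x Fin.≟ x) refl) (sym (cong₂ _+_
      (𝟙-true (dart-≟ d c) refl) (𝟙-false (dart-≟ (reverse d) c) (reverse-≢ d))))
    ... | no b≢b′ = trans (𝟙-true (x Fin.≟ x) refl) (sym (cong₂ _+_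
      (𝟙-false (dart-≟ d c) (b≢b′ ∘ cong proj₂))
          (𝟙-true (dart-≟ (reverse d) c) (cong (x ,_) (sym (Bool.¬-not (b≢b′ ∘ sym)))))))

  σ⁻-𝟙 : ∀ d c → δ (σ⁻ d) c ≡ δ d (σ⁺ c)
  σ⁻-𝟙 d c = 𝟙-cong (dart-≟ (σ⁻ d) c) (dart-≟ d (σ⁺ c))
    (λ eq → trans (sym (σ⁺σ⁻ d)) (cong σ⁺ eq)) (λ eq → trans (cong σ⁻ eq) (σ⁻σ⁺ c))

  σ⁺-𝟙 : ∀ b c → δ b c ≡ δ (σ⁺ b) (σ⁺ c)
  σ⁺-𝟙 b c = trans (cong (λ d → δ d c) (sym (σ⁻σ⁺ b))) (σ⁻-𝟙 (σ⁺ b) c)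

  indicator : Fin e → Fin e → ℤ
  indicator x y = 𝟙 (does (x Fin.≟ y))

  ψ : Dart × Bool → Dart × Bool
  ψ = Map.φ (angleMap G)

  -- The boundary of the face of the angle map surrounding the edge of `d`: it runs through `d`,
  -- `σ⁻ d`, `reverse d` and `σ⁻ (reverse d)`, alternately from dual to primal and from primal to
  -- dual.
  quad : Dart → List (Dart × Bool)
  quad d = iterate ψ (d , false) 4

  ∂-indicator : ∀ d c → ∂ (indicator (edge d)) c ≡
                δ d (σ⁺ c) + δ (reverse d) (σ⁺ c) -
                (δ d c + δ (reverse d) c)
  ∂-indicator d c = cong₂ _-_ (edge-𝟙 d (σ⁺ c)) (edge-𝟙 d c)

  -- A facial walk may start at any of its darts, so both kinds of starting dart are computed. The
  -- angle `σ⁻ d` is `c` exactly when `d` is `σ⁺ c`, which produces the terms at `σ⁺ c`.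
  quad-∂ : ∀ a c → walkFlow (iterate ψ a 4) c ≡ ε c * ∂ (indicator (Map.left (angleMap G) a)) c
  quad-∂ (d , false) c = trans (walkFlow-∑ (quad d) c) (cong (ε c *_) (begin
    -1ℤ * δ d c + (1ℤ * δ (σ⁻ d) c +
      (-1ℤ * δ (reverse (σ⁺ (σ⁻ d))) c + (1ℤ * δ (σ⁻ (reverse (σ⁺ (σ⁻ d)))) c + 0ℤ)))
      ≡⟨ cong (λ d′ → -1ℤ * δ d c + (1ℤ * δ (σ⁻ d) c +
           (-1ℤ * δ (reverse d′) c + (1ℤ * δ (σ⁻ (reverse d′)) c + 0ℤ)))) (σ⁺σ⁻ d) ⟩
    -1ℤ * δ d c + (1ℤ * δ (σ⁻ d) c +
      (-1ℤ * δ (reverse d) c + (1ℤ * δ (σ⁻ (reverse d)) c + 0ℤ)))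
      ≡⟨ cong₂ (λ x y → -1ℤ * δ d c + (1ℤ * x +
           (-1ℤ * δ (reverse d) c + (1ℤ * y + 0ℤ)))) (σ⁻-𝟙 d c) (σ⁻-𝟙 (reverse d) c) ⟩
    -1ℤ * δ d c + (1ℤ * δ d (σ⁺ c) +
      (-1ℤ * δ (reverse d) c + (1ℤ * δ (reverse d) (σ⁺ c) + 0ℤ)))
      ≡⟨ regroup (δ d c) (δ d (σ⁺ c)) (δ (reverse d) c) (δ (reverse d) (σ⁺ c)) ⟩
    _ ≡⟨ ∂-indicator d c ⟨
    ∂ (indicator (edge d)) c ∎))
    where
    regroup : ∀ w x y z → -1ℤ * w + (1ℤ * x + (-1ℤ * y + (1ℤ * z + 0ℤ))) ≡ x + z - (w + y)
    regroup = solve-∀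
  quad-∂ (b , true) c = trans (walkFlow-∑ (iterate ψ (b , true) 4) c) (cong (ε c *_) (begin
    1ℤ * δ b c + (-1ℤ * δ (reverse d) c +
      (1ℤ * δ (σ⁻ (reverse d)) c + (-1ℤ * δ (reverse (σ⁺ (σ⁻ (reverse d)))) c + 0ℤ)))
      ≡⟨ cong (λ d′ → 1ℤ * δ b c + (-1ℤ * δ (reverse d) c +
           (1ℤ * δ (σ⁻ (reverse d)) c + (-1ℤ * δ d′ c + 0ℤ))))
           (trans (cong reverse (σ⁺σ⁻ (reverse d))) (reverse-involutive d)) ⟩
    1ℤ * δ b c + (-1ℤ * δ (reverse d) c +
      (1ℤ * δ (σ⁻ (reverse d)) c + (-1ℤ * δ d c + 0ℤ)))
      ≡⟨ cong₂ (λ x y → 1ℤ * x + (-1ℤ * δ (reverse d) c +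
           (1ℤ * y + (-1ℤ * δ d c + 0ℤ)))) (σ⁺-𝟙 b c) (σ⁻-𝟙 (reverse d) c) ⟩
    1ℤ * δ d (σ⁺ c) + (-1ℤ * δ (reverse d) c +
      (1ℤ * δ (reverse d) (σ⁺ c) + (-1ℤ * δ d c + 0ℤ)))
      ≡⟨ regroup (δ d c) (δ d (σ⁺ c)) (δ (reverse d) c) (δ (reverse d) (σ⁺ c)) ⟩
    _ ≡⟨ ∂-indicator d c ⟨
    ∂ (indicator (edge d)) c ∎))
    where
    d : Dart
    d = σ⁺ b
    regroup : ∀ w x y z → 1ℤ * x + (-1ℤ * y + (1ℤ * z + (-1ℤ * w + 0ℤ))) ≡ x + z - (w + y)
    regroup = solve-∀

  -- Two steps along the face lead to the opposite dart of the surrounded edge.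
  ψ²-≢ : ∀ a → ψ (ψ a) ≢ a
  ψ²-≢ (d , false) eq = reverse-≢ d (trans (cong reverse (sym (σ⁺σ⁻ d))) (cong proj₁ eq))
  ψ²-≢ (b , true)  eq = reverse-≢ (σ⁺ b) (trans (sym (σ⁺σ⁻ _)) (cong (σ⁺ ∘ proj₁) eq))

  ψ⁴ : ∀ a → ψ (ψ (ψ (ψ a))) ≡ a
  ψ⁴ (d , false) = cong (_, false)
      (trans (cong reverse (trans (σ⁺σ⁻ _) (cong reverse (σ⁺σ⁻ d)))) (reverse-involutive d))
  ψ⁴ (b , true)  = cong (_, true)
      (trans (cong σ⁻ (trans (cong reverse (σ⁺σ⁻ _)) (reverse-involutive (σ⁺ b)))) (σ⁻σ⁺ b))

  quad-facial : ∀ d → FacialWalk (angleMap G) (quad d)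
  quad-facial d = once-around (d , false) 3 (ψ⁴ (d , false))
    (((λ ()) ∷ (ψ²-≢ (d , false) ∘ sym) ∷ (λ ()) ∷ [])
        ∷ ((λ ()) ∷ (ψ²-≢ (ψ (d , false)) ∘ sym) ∷ [])
        ∷ ((λ ()) ∷ []) ∷ [] ∷ [])

  -- Every facial walk has length four: `ψ` alternates primal and dual darts, which excludes lengths
  -- one and three, `ψ²-≢` excludes two, and `ψ⁴` makes any longer walk repeat its first dart.
  facial-∂ : ∀ {ds} → FacialWalk (angleMap G) ds → ∃[ x ] ∀ c → walkFlow ds c ≡ ε c * ∂ (indicator x) c
  facial-∂ (once-around (_ , false) 0 () _)
  facial-∂ (once-around (_ , true)  0 () _)
  facial-∂ (once-around a 1 eq _) = contradiction eq (ψ²-≢ a)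
  facial-∂ (once-around (_ , false) 2 () _)
  facial-∂ (once-around (_ , true)  2 () _)
  facial-∂ (once-around a 3 _ _) = Map.left (angleMap G) a , quad-∂ a
  facial-∂ (once-around a (suc (suc (suc (suc k)))) _ ((_ ∷ _ ∷ _ ∷ a≢ ∷ _) ∷ _)) =
      contradiction (sym (ψ⁴ a)) a≢

  -- The function `m` collects the coefficient of each quadrangle, by induction on the generation of
  -- the subgroup.
  Subgroup⇒∂ : ∀ {g} → Subgroup FacialFlow g → ∃[ m ] ∀ c → g c ≡ ε c * ∂ m c
  Subgroup⇒∂ (generator (facial walk)) = let x , eq = facial-∂ walk in indicator x , eq
  Subgroup⇒∂ zero = (λ _ → 0ℤ) , λ c → sym (ℤ.*-zeroʳ (ε c))
  Subgroup⇒∂ (add H K) =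
    let m , eq = Subgroup⇒∂ H
        n , eq′ = Subgroup⇒∂ K
    in (λ x → m x + n x) , λ c →
        trans (cong₂ _+_ (eq c) (eq′ c))
        (regroup (ε c) (m (edge (σ⁺ c))) (m (edge c)) (n (edge (σ⁺ c))) (n (edge c)))
    where
    regroup : ∀ k a b c d → k * (a - b) + k * (c - d) ≡ k * (a + c - (b + d))
    regroup = solve-∀
  Subgroup⇒∂ (negate H) =
    let m , eq = Subgroup⇒∂ H
    in (λ x → - m x) , λ c → trans (cong -_ (eq c)) (regroup (ε c) (m (edge (σ⁺ c))) (m (edge c)))
    where
    regroup : ∀ k a b → - (k * (a - b)) ≡ k * (- a - - b)
    regroup = solve-∀
  Subgroup⇒∂ (respects g≗h H) = let m , eq = Subgroup⇒∂ H in m , λ c → trans (sym (g≗h c)) (eq c)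

  -- Uses the combination of quadrangles with coefficients `m`. Starting each at `(x , true)` is
  -- harmless, as by `quad-∂` the flow depends only on the edge.
  ∂⇒Subgroup : ∀ m → Subgroup FacialFlow (λ c → ε c * ∂ m c)
  ∂⇒Subgroup m = respects expand
      (Subgroup-∑ (allFin e)
      (λ x → Subgroup-multiple (m x) (generator (facial (quad-facial (x , true))))))
    where
    pick : ∀ y → ∑ (allFin e) (λ x → indicator y x * m x) ≡ m y
    pick y = ∑-pick Fin._≟_ m (Unique.allFin⁺ e) (∈-allFin y)

    term : ∀ c x → m x * walkFlow (quad (x , true)) c ≡
                   ε c * (indicator (edge (σ⁺ c)) x * m x - indicator (edge c) x * m x)
    term c x = trans (cong (m x *_) (quad-∂ ((x , true) , false) c)) (trans
      (regroup (m x) (ε c) (indicator x (edge (σ⁺ c))) (indicator x (edge c)))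
      (cong₂ (λ a b → ε c * (a * m x - b * m x))
          (𝟙-cong (x Fin.≟ _) (_ Fin.≟ x) sym sym) (𝟙-cong (x Fin.≟ _) (_ Fin.≟ x) sym sym)))
      where
      regroup : ∀ k l a b → k * (l * (a - b)) ≡ l * (a * k - b * k)
      regroup = solve-∀

    expand : ∀ c → ∑ (allFin e) (λ x → m x * walkFlow (quad (x , true)) c) ≡ ε c * ∂ m c
    expand c = begin
      ∑ (allFin e) (λ x → m x * walkFlow (quad (x , true)) c)
        ≡⟨ ∑-cong (allFin e) (term c) ⟩
      ∑ (allFin e) (λ x → ε c * (indicator (edge (σ⁺ c)) x * m x - indicator (edge c) x * m x))
        ≡⟨ ∑-* (ε c) _ (allFin e) ⟩
      ε c * ∑ (allFin e) (λ x → indicator (edge (σ⁺ c)) x * m x - indicator (edge c) x * m x)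
        ≡⟨ cong (ε c *_) (trans (∑-- _ _ (allFin e)) (cong₂ _-_ (pick _) (pick _))) ⟩
      ε c * ∂ m c ∎

  homologous⇒∂ : ∀ {D D′} → Homologous D D′ → ∃[ m ] ∀ c → diff D D′ c ≡ ∂ m c
  homologous⇒∂ {D} {D′} H =
      let m , eq = Subgroup⇒∂ H
      in m , λ c → ε-cancel c (trans (sym (flow-∖ D D′ c)) (eq c))

  ∂⇒homologous : ∀ {D D′} m → (∀ c → diff D D′ c ≡ ∂ m c) → Homologous D D′
  ∂⇒homologous {D} {D′} m eq =
      respects (λ c → sym (trans (flow-∖ D D′ c) (cong (ε c *_) (eq c))))
      (∂⇒Subgroup m)

-- Closed walks and cycles

same-edge : ∀ (c d : A × Bool) → proj₁ c ≡ proj₁ d → c ≡ d ⊎ c ≡ reverse d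
same-edge (x , b) (x , b′) refl with b Bool.≟ b′
... | yes refl = inj₁ refl
... | no  b≢b′ = inj₂ (cong (x ,_) (Bool.¬-not b≢b′))

unique-injective : ∀ (g : A → B) {xs x y} → Unique (map g xs) → x ∈ xs → y ∈ xs → g x ≡ g y → x ≡ y
unique-injective g (_ ∷ _)     (here refl)  (here refl)  _  = refl
unique-injective g (x∉ ∷ _)    (here refl)  (there y∈)   eq = contradiction eq (All.lookup x∉ (∈-map⁺ g y∈))
unique-injective g (x∉ ∷ _)    (there x∈)   (here refl)  eq = contradiction (sym eq) (All.lookup x∉ (∈-map⁺ g x∈))
unique-injective g (_ ∷ xs!)   (there x∈)   (there y∈)   eq = unique-injective g xs! x∈ y∈ eq

unique-rotate : ∀ {x : A} {xs} → Unique (x ∷ xs) → Unique (xs ∷ʳ x)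
unique-rotate (x∉xs ∷ xs!) = Unique.++⁺ xs! ([] ∷ []) λ { (x∈xs , here refl) → All.lookup x∉xs x∈xs refl }

-- The whole splitting of the list is kept, since closed walks will be cut at the two entries.
data Repeat (g : A → B) : List A → Set where
  repeat : ∀ xs a ys b zs → g a ≡ g b → Repeat g (xs ++ a ∷ ys ++ b ∷ zs)

unique-or-repeat : DecidableEquality B → ∀ (g : A → B) xs → Unique (map g xs) ⊎ Repeat g xs
unique-or-repeat _≟_ g [] = inj₁ []
unique-or-repeat _≟_ g (x ∷ xs) with any? (λ y → g x ≟ g y) xs | unique-or-repeat _≟_ g xs
... | no  x∉ | inj₁ xs! = inj₁ (All.map⁺ (All.¬Any⇒All¬ xs x∉) ∷ xs!)
... | no  _  | inj₂ (repeat ys a zs b ws eq) = inj₂ (repeat (x ∷ ys) a zs b ws eq)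
... | yes x∈ | _ with find x∈
...   | y , y∈xs , eq with ∈-∃++ y∈xs
...     | ys , zs , refl = inj₂ (repeat [] x ys y zs eq)

-- Outdegrees and invariance under `∂`

module Balance (G : FiniteMap v e f) where
  open OnMap G

  outdegree-src : ∀ O x → pos (outdegree G O (inj₁ x)) ≡ ∑-at (𝟙 ∘ O) x
  outdegree-src O x =
      trans (length-filter (λ c → ⊎-≡-dec Fin._≟_ Fin._≟_ (tail G O c) (inj₁ x)) (darts e))
      (∑-cong (darts e) λ c → term c (O c))
    where
    term : ∀ c b → 𝟙 (does (⊎-≡-dec Fin._≟_ Fin._≟_ (Map.src (angleMap G) (c , b)) (inj₁ x))) ≡
                   𝟙 (does (src c Fin.≟ x)) * 𝟙 b
    term c true  = trans
        (𝟙-cong (⊎-≡-dec Fin._≟_ Fin._≟_ (inj₁ (src c)) (inj₁ x)) (src c Fin.≟ x)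
        inj₁-injective (cong (inj₁ {B = Fin f})))
                         (sym (ℤ.*-identityʳ _))
    term c false = sym (ℤ.*-zeroʳ (𝟙 (does (src c Fin.≟ x))))

  outdegree-left : ∀ O g → pos (outdegree G O (inj₂ g)) ≡ ∑-around (λ c → 1ℤ - 𝟙 (O c)) g
  outdegree-left O g =
      trans (length-filter (λ c → ⊎-≡-dec Fin._≟_ Fin._≟_ (tail G O c) (inj₂ g)) (darts e))
      (∑-cong (darts e) λ c → term c (O c))
    where
    term : ∀ c b → 𝟙 (does (⊎-≡-dec Fin._≟_ Fin._≟_ (Map.src (angleMap G) (c , b)) (inj₂ g))) ≡
                   𝟙 (does (left c Fin.≟ g)) * (1ℤ - 𝟙 b)
    term c true  = sym (ℤ.*-zeroʳ (𝟙 (does (left c Fin.≟ g))))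
    term c false = trans
        (𝟙-cong (⊎-≡-dec Fin._≟_ Fin._≟_ (inj₂ (left c)) (inj₂ g)) (left c Fin.≟ g)
        inj₂-injective (cong (inj₂ {A = Fin v})))
                         (sym (ℤ.*-identityʳ _))

  outdegree-src-diff : ∀ D D′ x →
      pos (outdegree G D (inj₁ x)) - pos (outdegree G D′ (inj₁ x)) ≡ ∑-at (diff D D′) x
  outdegree-src-diff D D′ x = trans (cong₂ _-_ (outdegree-src D x) (outdegree-src D′ x))
    (trans (sym (∑-- _ _ (darts e)))
        (∑-cong (darts e) λ c → sym (*-distribˡ-- (𝟙 (does (src c Fin.≟ x))) (𝟙 (D c)) (𝟙 (D′ c)))))

  -- An angle leaves its dual-vertex exactly when it does not leave its primal-vertex, which
  -- exchanges the roles of `D` and `D′`.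
  outdegree-left-diff : ∀ D D′ g →
      pos (outdegree G D′ (inj₂ g)) - pos (outdegree G D (inj₂ g)) ≡ ∑-around (diff D D′) g
  outdegree-left-diff D D′ g = trans (cong₂ _-_ (outdegree-left D′ g) (outdegree-left D g))
    (trans (sym (∑-- _ _ (darts e)))
        (∑-cong (darts e) λ c → distrib (𝟙 (does (left c Fin.≟ g))) (𝟙 (D c)) (𝟙 (D′ c))))
    where
    distrib : ∀ k a b → k * (1ℤ - b) - k * (1ℤ - a) ≡ k * (a - b)
    distrib = solve-∀

  ∑-at-telescopes : ∀ (p : Dart → ℤ) x → ∑-at (λ c → p (σ⁺ c) - p c) x ≡ 0ℤ
  ∑-at-telescopes p x = begin
    ∑-at (λ c → p (σ⁺ c) - p c) x
      ≡⟨ ∑-cong (darts e) term ⟩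
    ∑ (darts e) (λ c → 𝟙 (does (src (σ⁺ c) Fin.≟ x)) * p (σ⁺ c) - 𝟙 (does (src c Fin.≟ x)) * p c)
      ≡⟨ ∑-- _ _ (darts e) ⟩
    ∑ (darts e) (λ c → 𝟙 (does (src (σ⁺ c) Fin.≟ x)) * p (σ⁺ c)) - ∑-at p x
      ≡⟨ cong (_- ∑-at p x) (∑-σ⁺ _) ⟩
    ∑-at p x - ∑-at p x
      ≡⟨ ℤ.+-inverseʳ (∑-at p x) ⟩
    0ℤ ∎
    where
    term : ∀ c → 𝟙 (does (src c Fin.≟ x)) * (p (σ⁺ c) - p c) ≡
                 𝟙 (does (src (σ⁺ c) Fin.≟ x)) * p (σ⁺ c) - 𝟙 (does (src c Fin.≟ x)) * p c
    term c = trans (*-distribˡ-- (𝟙 (does (src c Fin.≟ x))) (p (σ⁺ c)) (p c))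
      (cong (λ y → 𝟙 (does (y Fin.≟ x)) * p (σ⁺ c) - 𝟙 (does (src c Fin.≟ x)) * p c) (sym (src-σ⁺ c)))

  -- Reindexing by `φ` identifies the two sums: `φ` preserves the left face, and `σ⁺ (φ c)` is the
  -- reverse of `c`, with the same edge.
  ∑-around-telescopes : ∀ (m : Fin e → ℤ) g → ∑-around (∂ m) g ≡ 0ℤ
  ∑-around-telescopes m g = begin
    ∑-around (∂ m) g
      ≡⟨ ∑-cong (darts e) (λ c → *-distribˡ-- (𝟙 (does (left c Fin.≟ g))) (m (edge (σ⁺ c))) (m (edge c))) ⟩
    ∑ (darts e) (λ c → 𝟙 (does (left c Fin.≟ g)) * m (edge (σ⁺ c)) - 𝟙 (does (left c Fin.≟ g)) * m (edge c))
      ≡⟨ ∑-- _ _ (darts e) ⟩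
    ∑-around (λ c → m (edge (σ⁺ c))) g - ∑-around (m ∘ edge) g
      ≡⟨ cong (_- ∑-around (m ∘ edge) g) (∑-φ _) ⟨
    ∑ (darts e) (λ c → 𝟙 (does (left (φ c) Fin.≟ g)) * m (edge (σ⁺ (φ c)))) - ∑-around (m ∘ edge) g
      ≡⟨ cong (_- ∑-around (m ∘ edge) g) (∑-cong (darts e) (λ c →
           cong₂ (λ h y → 𝟙 (does (h Fin.≟ g)) * m y) (left-φ c) (cong edge (σ⁺φ c)))) ⟩
    ∑-around (m ∘ edge) g - ∑-around (m ∘ edge) g
      ≡⟨ ℤ.+-inverseʳ (∑-around (m ∘ edge) g) ⟩
    0ℤ ∎

  ∂⇒balanced : ∀ {D D′} (m : Fin e → ℤ) → (∀ c → diff D D′ c ≡ ∂ m c) →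
               IsBalanced4Orientation G D → IsBalanced4Orientation G D′
  ∂⇒balanced {D} {D′} m diff-m ((four , one) , balanced) = (four′ , one′) , balanced′
    where
    four′ : ∀ x → outdegree G D′ (inj₁ x) ≡ 4
    four′ x = trans (sym (ℤ.+-injective (ℤ.i-j≡0⇒i≡j _ _ (begin
      pos (outdegree G D (inj₁ x)) - pos (outdegree G D′ (inj₁ x))
        ≡⟨ outdegree-src-diff D D′ x ⟩
      ∑-at (diff D D′) x
        ≡⟨ ∑-cong (darts e) (λ c → cong (𝟙 (does (src c Fin.≟ x)) *_) (diff-m c)) ⟩
      ∑-at (∂ m) x
        ≡⟨ ∑-at-telescopes (m ∘ edge) x ⟩
      0ℤ ∎)))) (four x)

    one′ : ∀ g → outdegree G D′ (inj₂ g) ≡ 1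
    one′ g = trans (ℤ.+-injective (ℤ.i-j≡0⇒i≡j _ _ (begin
      pos (outdegree G D′ (inj₂ g)) - pos (outdegree G D (inj₂ g))
        ≡⟨ outdegree-left-diff D D′ g ⟩
      ∑-around (diff D D′) g
        ≡⟨ ∑-cong (darts e) (λ c → cong (𝟙 (does (left c Fin.≟ g)) *_) (diff-m c)) ⟩
      ∑-around (∂ m) g
        ≡⟨ ∑-around-telescopes m g ⟩
      0ℤ ∎))) (one g)

    balanced′ : Balanced G D′
    balanced′ C ¬contractible = trans (sym (ℤ.i-j≡0⇒i≡j _ _ (begin
      γ G D C - γ G D′ C
        ≡⟨ γ-diff {p = m ∘ edge} diff-m C ⟩
      pos 2 * ∑ (Cycle.steps C) (λ d → m (edge d) - m (edge d))
        -- The potential `m ∘ edge` agrees on a dart and its reverse, so all jumps vanish.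
        ≡⟨ cong (pos 2 *_) (∑-zero (Cycle.steps C) (λ {d} _ → ℤ.+-inverseʳ (m (edge d)))) ⟩
      0ℤ ∎))) (balanced C ¬contractible)

  -- Boundaries of weighted faces and summation by parts

  boundary-of : (Fin f → ℤ) → Dart → ℤ
  boundary-of k c = k (left (reverse c)) - k (left c)

  boundary-σ⁺ : ∀ k c → boundary-of k (σ⁺ c) ≡ k (left c) - k (left (σ⁺ c))
  boundary-σ⁺ k c = cong (λ g → k g - k (left (σ⁺ c))) (trans (sym (left-σ⁻ (σ⁺ c))) (cong left (σ⁻σ⁺ c)))

  boundary-reverse : ∀ k c → boundary-of k (reverse c) ≡ - boundary-of k c
  boundary-reverse k c = trans (cong (λ d → k (left d) - k (left (reverse c))) (reverse-involutive c))
    (sym (neg-- (k (left (reverse c))) (k (left c))))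

  -- A boundary is a circulation: the face on the right of `σ⁺ c` is the face on the left of `c`, so
  -- the contributions around `x` telescope.
  ∑-at-boundary : ∀ k x → ∑-at (boundary-of k) x ≡ 0ℤ
  ∑-at-boundary k x = begin
    ∑-at (boundary-of k) x
      ≡⟨ ∑-σ⁺ _ ⟨
    ∑ (darts e) (λ c → 𝟙 (does (src (σ⁺ c) Fin.≟ x)) * boundary-of k (σ⁺ c))
      ≡⟨ ∑-cong (darts e) (λ c → cong₂ (λ y b → 𝟙 (does (y Fin.≟ x)) * b)
          (src-σ⁺ c) (trans (boundary-σ⁺ k c) (swap (k (left c)) (k (left (σ⁺ c)))))) ⟩
    ∑-at (λ c → - k (left (σ⁺ c)) - - k (left c)) x
      ≡⟨ ∑-at-telescopes (λ c → - k (left c)) x ⟩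
    0ℤ ∎
    where
    swap : ∀ a b → a - b ≡ - b - - a
    swap a b = trans (ℤ.+-comm a (- b)) (cong (λ z → - b + z) (sym (ℤ.neg-involutive a)))

  ∑-faces : ∀ {h : Dart → ℤ} → (∀ g → ∑-around h g ≡ 0ℤ) → ∀ (k : Fin f → ℤ) →
            ∑ (darts e) (λ c → k (left c) * h c) ≡ 0ℤ
  ∑-faces {h} closed k = begin
    ∑ (darts e) (λ c → k (left c) * h c)
      ≡⟨ ∑-cong (darts e) (λ c → ∑-pick Fin._≟_ (λ g → k g * h c) (Unique.allFin⁺ f) (∈-allFin (left c))) ⟨
    ∑ (darts e) (λ c → ∑ (allFin f) (λ g → 𝟙 (does (left c Fin.≟ g)) * (k g * h c)))
      ≡⟨ ∑-swap _ (darts e) (allFin f) ⟩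
    ∑ (allFin f) (λ g → ∑ (darts e) (λ c → 𝟙 (does (left c Fin.≟ g)) * (k g * h c)))
      ≡⟨ ∑-zero (allFin f) (λ {g} _ →
          trans (∑-cong (darts e) (λ c → swap (𝟙 (does (left c Fin.≟ g))) (k g) (h c)))
           (trans (∑-* (k g) (λ c → 𝟙 (does (left c Fin.≟ g)) * h c) (darts e))
               (trans (cong (k g *_) (closed g)) (ℤ.*-zeroʳ (k g))))) ⟩
    0ℤ ∎
    where
    swap : ∀ a b c → a * (b * c) ≡ b * (a * c)
    swap = solve-∀

  module _ {h p : Dart → ℤ} (h-p : ∀ c → h c ≡ p (σ⁺ c) - p c) (closed : ∀ g → ∑-around h g ≡ 0ℤ) where

    -- Reindexing the right-face term by `σ⁺` gives both terms the weight `k (left c)`. The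
    -- difference then falls on `p`, where it is `h`, whose sum around each face vanishes.
    stokes : ∀ (k : Fin f → ℤ) → ∑ (darts e) (λ c → boundary-of k c * p c) ≡ 0ℤ
    stokes k = begin
      ∑ (darts e) (λ c → boundary-of k c * p c)
        ≡⟨ ∑-cong (darts e) (λ c → distrib (p c) (k (left (reverse c))) (k (left c))) ⟩
      ∑ (darts e) (λ c → k (left (reverse c)) * p c - k (left c) * p c)
        ≡⟨ ∑-- _ _ (darts e) ⟩
      ∑ (darts e) (λ c → k (left (reverse c)) * p c) - ∑ (darts e) (λ c → k (left c) * p c)
        ≡⟨ cong (_- ∑ (darts e) (λ c → k (left c) * p c)) (∑-σ⁺ _) ⟨
      ∑ (darts e) (λ c → k (left (reverse (σ⁺ c))) * p (σ⁺ c)) - ∑ (darts e) (λ c → k (left c) * p c)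
        ≡⟨ ∑-- _ _ (darts e) ⟨
      ∑ (darts e) (λ c → k (left (reverse (σ⁺ c))) * p (σ⁺ c) - k (left c) * p c)
        ≡⟨ ∑-cong (darts e) term ⟩
      ∑ (darts e) (λ c → k (left c) * h c)
        ≡⟨ ∑-faces closed k ⟩
      0ℤ ∎
      where
      distrib : ∀ k a b → (a - b) * k ≡ a * k - b * k
      distrib = solve-∀
      term : ∀ c → k (left (reverse (σ⁺ c))) * p (σ⁺ c) - k (left c) * p c ≡ k (left c) * h c
      term c = trans (cong (λ g → k g * p (σ⁺ c) - k (left c) * p c)
          (trans (sym (left-σ⁻ (σ⁺ c))) (cong left (σ⁻σ⁺ c))))
        (trans (sym (*-distribˡ-- (k (left c)) (p (σ⁺ c)) (p c))) (cong (k (left c) *_) (sym (h-p c))))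

  tgt-src : ∀ u d ds z → Walk u (d ∷ ds) (src z) → map tgt (d ∷ ds) ≡ map src ds ∷ʳ src z
  tgt-src u d []        z (_ , eq)        = cong (_∷ []) eq
  tgt-src u d (d′ ∷ ds) z (_ , eq , walk) = cong₂ _∷_ (sym eq) (tgt-src (src d′) d′ ds z (refl , walk))

  -- Circulations carried by a cycle

  module _ (C : Cycle G) where
    open Cycle C

    targets-once : Unique (map tgt steps)
    targets-once = subst Unique (sym (tgt-src _ first rest first closed)) (unique-rotate vertices-once)

    -- Either `c` or its reverse is a step of the cycle. Distinctness of the sources settles the
    -- first case, distinctness of the targets the second.
    cycle-darts : ∀ {d d′ c} → d ∈ steps → d′ ∈ steps → tgt d ≡ src d′ →
                  edge c ∈ map edge steps → src c ≡ src d′ → c ≡ d′ ⊎ c ≡ reverse d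
    cycle-darts {d} {d′} {c} d∈ d′∈ meet c∈ at with ∈-map⁻ edge c∈
    ... | a , a∈ , same with same-edge c a same
    ...   | inj₁ refl = inj₁ (unique-injective src vertices-once a∈ d′∈ at)
    ...   | inj₂ refl = inj₂ (cong reverse (unique-injective tgt targets-once a∈ d∈ (trans at (sym meet))))

    module _ {t : Dart → ℤ} (t-reverse : ∀ c → t (reverse c) ≡ - t c) (t-at : ∀ x → ∑-at t x ≡ 0ℤ)
             (t-off : ∀ c → edge c ∉ map edge steps → t c ≡ 0ℤ) where

      -- At a vertex of the cycle, t is supported on the dart leaving it and the
      -- reverse of the dart entering it.
      chain-step : ∀ {d d′} → d ∈ steps → d′ ∈ steps → tgt d ≡ src d′ → t d′ ≡ t d
      chain-step {d} {d′} d∈ d′∈ meet = ℤ.i-j≡0⇒i≡j (t d′) (t d) (begin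
        t d′ - t d
          ≡⟨ cong (λ z → t d′ + z) (t-reverse d) ⟨
        t d′ + t (reverse d)
          ≡⟨ cong₂ _+_ (ℤ.*-identityˡ (t d′)) (trans (ℤ.+-identityʳ _) (ℤ.*-identityˡ (t (reverse d)))) ⟨
        1ℤ * t d′ + (1ℤ * t (reverse d) + 0ℤ)
          ≡⟨ cong₂ (λ a b → a * t d′ + (b * t (reverse d) + 0ℤ))
              (𝟙-true (src d′ Fin.≟ src d′) refl)
              (𝟙-true (tgt d Fin.≟ src d′) meet) ⟨
        ∑ (d′ ∷ reverse d ∷ []) (λ c → 𝟙 (does (src c Fin.≟ src d′)) * t c)
          ≡⟨ ∑-support dart-≟ _ (darts! e) ((d′≢ ∷ []) ∷ [] ∷ []) (λ _ → ∈-darts _) (λ _ → off) ⟨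
        ∑-at t (src d′)
          ≡⟨ t-at (src d′) ⟩
        0ℤ ∎)
        where
        open DecMembership Fin._≟_ using () renaming (_∈?_ to _∈ᵉ?_)
        -- Going straight back along an edge is excluded by `edges-once`, so the two darts at the
        -- vertex are distinct.
        d′≢ : d′ ≢ reverse d
        d′≢ eq = reverse-≢ d (trans (sym eq) (unique-injective edge edges-once d′∈ d∈ (cong edge eq)))
        off : ∀ {c} → c ∉ d′ ∷ reverse d ∷ [] → 𝟙 (does (src c Fin.≟ src d′)) * t c ≡ 0ℤ
        off {c} c∉ with src c Fin.≟ src d′ | edge c ∈ᵉ? map edge steps
        ... | no  _  | _      = refl
        ... | yes _  | no  c∉C = trans (ℤ.*-identityˡ _) (t-off c c∉C)
        ... | yes at | yes c∈C with cycle-darts d∈ d′∈ meet c∈C at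
        ...   | inj₁ refl = contradiction (here refl) c∉
        ...   | inj₂ refl = contradiction (there (here refl)) c∉

      chain-constant : ∀ {u w} d ds → Walk u (d ∷ ds) w → (∀ {a} → a ∈ d ∷ ds → a ∈ steps) →
                       ∀ {a} → a ∈ d ∷ ds → t a ≡ t d
      chain-constant d ds        walk sub (here refl) = refl
      chain-constant d (d′ ∷ ds) (_ , eq , walk) sub (there a∈) =
        trans (chain-constant d′ ds (refl , walk) (sub ∘ there) a∈)
              (chain-step (sub (here refl)) (sub (there (here refl))) (sym eq))

      -- By `chain-constant`, `t` equals `t first` on the steps; it is the opposite on their
      -- reverses and zero elsewhere.
      ∑-chain : ∀ (p : Dart → ℤ) → ∑ (darts e) (λ c → t c * p c) ≡
          t first * ∑ steps (λ d → p d - p (reverse d))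
      ∑-chain p = begin
        ∑ (darts e) (λ c → t c * p c)
          ≡⟨ ∑-support dart-≟ _ (darts! e) both-once (λ _ → ∈-darts _) (λ _ → off) ⟩
        ∑ (steps ++ map reverse steps) (λ c → t c * p c)
          ≡⟨ ∑-++ tp steps (map reverse steps) ⟩
        ∑ steps (λ c → t c * p c) + ∑ (map reverse steps) (λ c → t c * p c)
          ≡⟨ cong (∑ steps (λ c → t c * p c) +_) (∑-map tp reverse steps) ⟩
        ∑ steps (λ c → t c * p c) + ∑ steps (λ c → t (reverse c) * p (reverse c))
          ≡⟨ ∑-+ tp (tp ∘ reverse) steps ⟨
        ∑ steps (λ c → t c * p c + t (reverse c) * p (reverse c))
          ≡⟨ ∑-cong-∈ steps term ⟩
        ∑ steps (λ d → t first * (p d - p (reverse d)))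
          ≡⟨ ∑-* (t first) _ steps ⟩
        t first * ∑ steps (λ d → p d - p (reverse d)) ∎
        where
        open DecMembership Fin._≟_ using () renaming (_∈?_ to _∈ᵉ?_)
        tp : Dart → ℤ
        tp c = t c * p c
        reverse-injective : ∀ {c d : Dart} → reverse c ≡ reverse d → c ≡ d
        reverse-injective {c} {d} eq = trans (sym (reverse-involutive c))
            (trans (cong reverse eq) (reverse-involutive d))
        both-once : Unique (steps ++ map reverse steps)
        both-once = Unique.++⁺ (Unique.map⁻ edges-once)
            (Unique.map⁺ reverse-injective (Unique.map⁻ edges-once))
            disjoint
          where
          disjoint : ∀ {c} → ¬ (c ∈ steps × c ∈ map reverse steps)
          disjoint (c∈ , c∈ʳ) with ∈-map⁻ reverse c∈ʳ
          ... | d , d∈ , refl = reverse-≢ d (unique-injective edge edges-once c∈ d∈ refl)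
        off : ∀ {c} → c ∉ steps ++ map reverse steps → t c * p c ≡ 0ℤ
        off {c} c∉ with edge c ∈ᵉ? map edge steps
        ... | no  c∉C = cong (_* p c) (t-off c c∉C)
        ... | yes c∈C with ∈-map⁻ edge c∈C
        ...   | a , a∈ , same with same-edge c a same
        ...     | inj₁ refl = contradiction (∈-++⁺ˡ a∈) c∉
        ...     | inj₂ refl = contradiction (∈-++⁺ʳ steps (∈-map⁺ reverse a∈)) c∉
        regroup : ∀ k a b → k * a + - k * b ≡ k * (a - b)
        regroup = solve-∀
        term : ∀ {d} → d ∈ steps → t d * p d + t (reverse d) * p (reverse d) ≡ t first * (p d - p (reverse d))
        term {d} d∈ = trans (cong (λ k → t d * p d + k * p (reverse d)) (t-reverse d))
          (trans (regroup (t d) (p d) (p (reverse d)))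
                 (cong (_* (p d - p (reverse d))) (chain-constant first rest closed (λ a∈ → a∈) d∈)))

    module _ {h p : Dart → ℤ} (h-p : ∀ c → h c ≡ p (σ⁺ c) - p c) (h-closed : ∀ g → ∑-around h g ≡ 0ℤ) where

      -- With `k` the indicator of the enclosed faces, the boundary `t` is a nonzero multiple of the
      -- cycle. By `stokes` its pairing with `p` vanishes, and the multiple can be cancelled.
      contractible-zero : Contractible G C → ∑ steps (λ d → p d - p (reverse d)) ≡ 0ℤ
      contractible-zero disk = cancel (t-on (here refl)) (trans
        (sym (∑-chain (boundary-reverse k) (∑-at-boundary k) t-off p)) (stokes {p = p} h-p h-closed k))
        where
        open BoundsOpenDisk disk
        k : Fin f → ℤ
        k g = 𝟙 (does (g ∈ˢ? faces))
        t : Dart → ℤ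
        t = boundary-of k

        -- The darts `c` and `reverse c` share their edge, so its membership in `edges` carries over
        -- to the other side.
        transfer : ∀ c → edge c ∉ map edge steps → left c ∈ˢ faces → left (reverse c) ∈ˢ faces
        transfer c c∉ l∈ = proj₂ (Equivalence.to (interior-edge (reverse c))
            (Equivalence.from (interior-edge c) (c∉ , l∈)))

        t-off : ∀ c → edge c ∉ map edge steps → t c ≡ 0ℤ
        t-off c c∉ = ℤ.i≡j⇒i-j≡0 (𝟙-cong (left (reverse c) ∈ˢ? faces) (left c ∈ˢ? faces)
          (λ l∈ → subst (λ d → left d ∈ˢ faces) (reverse-involutive c) (transfer (reverse c) c∉ l∈)) (transfer c c∉))

        t-on : ∀ {d} → d ∈ steps → t d ≢ 0ℤ
        t-on {d} d∈ with left d ∈ˢ? faces | left (reverse d) ∈ˢ? faces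
        ... | yes l∈ | yes r∈ = contradiction r∈ (Equivalence.to (boundary d (∈-map⁺ edge d∈)) l∈)
        ... | yes _  | no  _  = λ ()
        ... | no  _  | yes _  = λ ()
        ... | no  l∉ | no  r∉ = contradiction (Equivalence.from (boundary d (∈-map⁺ edge d∈)) r∉) l∉

        cancel : ∀ {a b} → a ≢ 0ℤ → a * b ≡ 0ℤ → b ≡ 0ℤ
        cancel {a} a≢0 eq with ℤ.i*j≡0⇒i≡0∨j≡0 a eq
        ... | inj₁ a≡0 = contradiction a≡0 a≢0
        ... | inj₂ b≡0 = b≡0

  -- Decomposition of closed walks

  Walk-++⁻ : ∀ {u w} xs {ys} → Walk u (xs ++ ys) w → ∃[ m ] Walk u xs m × Walk m ys w
  Walk-++⁻ []       walk        = _ , refl , walk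
  Walk-++⁻ (x ∷ xs) (eq , walk) = let m , walk₁ , walk₂ = Walk-++⁻ xs walk in m , (eq , walk₁) , walk₂

  Walk-++⁺ : ∀ {u m w} xs {ys} → Walk u xs m → Walk m ys w → Walk u (xs ++ ys) w
  Walk-++⁺ []       refl        walk = walk
  Walk-++⁺ (x ∷ xs) (eq , walk₁) walk₂ = eq , Walk-++⁺ xs walk₁ walk₂

  module _ {j : Dart → ℤ} (j-reverse : ∀ d → j (reverse d) ≡ - j d)
           (j-cycle : ∀ (C : Cycle G) → ∑ (Cycle.steps C) j ≡ 0ℤ) where

    -- Induction on a bound `n` for the length: a nonempty closed walk that is not a cycle repeats a
    -- vertex or an edge, and reduces to two closed walks of length at most `n - 1`.
    closed-walk-zero : ∀ n {u} ds → length ds ℕ.≤ n → Walk u ds u → ∑ ds j ≡ 0ℤ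

    -- Cutting at the two visits of the vertex leaves the closed walks `a ∷ ys` and `xs ++ b ∷ zs`,
    -- both shorter since each misses at least one dart.
    split-vertex : ∀ n {u} xs a ys b zs → src a ≡ src b → length (xs ++ a ∷ ys ++ b ∷ zs) ℕ.≤ suc n →
                   Walk u (xs ++ a ∷ ys ++ b ∷ zs) u → ∑ (xs ++ a ∷ ys ++ b ∷ zs) j ≡ 0ℤ
    split-vertex n xs a ys b zs same short walk
      with _ , walk₁ , refl , walk₂ ← Walk-++⁻ xs walk
      with _ , walk₃ , refl , walk₄ ← Walk-++⁻ ys walk₂ = begin
        ∑ (xs ++ a ∷ ys ++ b ∷ zs) j
          ≡⟨ trans (∑-++ j xs _) (cong (λ s → ∑ xs j + (j a + s)) (∑-++ j ys (b ∷ zs))) ⟩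
        ∑ xs j + (j a + (∑ ys j + ∑ (b ∷ zs) j))
          ≡⟨ regroup (∑ xs j) (j a) (∑ ys j) (∑ (b ∷ zs) j) ⟩
        ∑ (a ∷ ys) j + (∑ xs j + ∑ (b ∷ zs) j)
          ≡⟨ cong (∑ (a ∷ ys) j +_) (∑-++ j xs (b ∷ zs)) ⟨
        ∑ (a ∷ ys) j + ∑ (xs ++ b ∷ zs) j
          ≡⟨ cong₂ _+_
               (closed-walk-zero n (a ∷ ys) (ℕ.m+n≤o⇒m≤o _ total)
                   (refl , subst (Walk (tgt a) ys) (sym same) walk₃))
               (closed-walk-zero n (xs ++ b ∷ zs)
                   (ℕ.≤-trans (ℕ.≤-reflexive (List.length-++ xs))
                   (ℕ.≤-pred (ℕ.m+n≤o⇒n≤o (length ys) total′)))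
                 (Walk-++⁺ xs walk₁ (sym same , walk₄))) ⟩
        0ℤ ∎
      where
      regroup : ∀ x a y z → x + (a + (y + z)) ≡ a + y + (x + z)
      regroup = solve-∀
      count : ∀ x y z → x ℕ.+ suc (y ℕ.+ suc z) ≡ y ℕ.+ suc (x ℕ.+ suc z)
      count = solveℕ-∀
      count₂ : ∀ x y z → y ℕ.+ suc (x ℕ.+ suc z) ≡ suc (suc y ℕ.+ (x ℕ.+ z))
      count₂ = solveℕ-∀
      len : length (xs ++ a ∷ ys ++ b ∷ zs) ≡ length ys ℕ.+ suc (length xs ℕ.+ suc (length zs))
      len = trans (List.length-++ xs) (trans (cong (λ k → length xs ℕ.+ suc k) (List.length-++ ys))
        (count (length xs) (length ys) (length zs)))
      total′ : length ys ℕ.+ suc (length xs ℕ.+ suc (length zs)) ℕ.≤ suc n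
      total′ = subst (ℕ._≤ suc n) len short
      total : suc (length ys) ℕ.+ (length xs ℕ.+ length zs) ℕ.≤ n
      total = ℕ.≤-pred (subst (ℕ._≤ suc n) (count₂ (length xs) (length ys) (length zs)) total′)

    -- The opposite traversals of the edge cancel. What remains is `ys`, closed at the target of
    -- `a`, and `xs ++ zs`, which closes up because `reverse a` returns to the source of `a`.
    split-spur : ∀ n {u} xs a ys zs → length (xs ++ a ∷ ys ++ reverse a ∷ zs) ℕ.≤ suc n →
                 Walk u (xs ++ a ∷ ys ++ reverse a ∷ zs) u → ∑ (xs ++ a ∷ ys ++ reverse a ∷ zs) j ≡ 0ℤ
    split-spur n xs a ys zs short walk
      with _ , walk₁ , refl , walk₂ ← Walk-++⁻ xs walk
      with _ , walk₃ , refl , walk₄ ← Walk-++⁻ ys walk₂ = begin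
        ∑ (xs ++ a ∷ ys ++ reverse a ∷ zs) j
          ≡⟨ trans (∑-++ j xs _) (cong (λ s → ∑ xs j + (j a + s)) (∑-++ j ys (reverse a ∷ zs))) ⟩
        ∑ xs j + (j a + (∑ ys j + (j (reverse a) + ∑ zs j)))
          ≡⟨ cong (λ s → ∑ xs j + (j a + (∑ ys j + (s + ∑ zs j)))) (j-reverse a) ⟩
        ∑ xs j + (j a + (∑ ys j + (- j a + ∑ zs j)))
          ≡⟨ regroup (∑ xs j) (j a) (∑ ys j) (∑ zs j) ⟩
        ∑ ys j + (∑ xs j + ∑ zs j)
          ≡⟨ cong (∑ ys j +_) (∑-++ j xs zs) ⟨
        ∑ ys j + ∑ (xs ++ zs) j
          ≡⟨ cong₂ _+_
               (closed-walk-zero n ys (ℕ.m+n≤o⇒m≤o _ total) walk₃)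
               (closed-walk-zero n (xs ++ zs)
                   (ℕ.≤-trans (ℕ.≤-reflexive (List.length-++ xs)) (ℕ.m+n≤o⇒n≤o (length ys) total))
                 (Walk-++⁺ xs walk₁ (subst (λ d → Walk (src d) zs _) (reverse-involutive a) walk₄))) ⟩
        0ℤ ∎
      where
      regroup : ∀ x a y z → x + (a + (y + (- a + z))) ≡ y + (x + z)
      regroup = solve-∀
      count : ∀ x y z → x ℕ.+ suc (y ℕ.+ suc z) ≡ suc (suc (y ℕ.+ (x ℕ.+ z)))
      count = solveℕ-∀
      len : length (xs ++ a ∷ ys ++ reverse a ∷ zs) ≡ suc (suc (length ys ℕ.+ (length xs ℕ.+ length zs)))
      len = trans (List.length-++ xs) (trans (cong (λ k → length xs ℕ.+ suc k) (List.length-++ ys))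
        (count (length xs) (length ys) (length zs)))
      total : length ys ℕ.+ (length xs ℕ.+ length zs) ℕ.≤ n
      total = ℕ.<⇒≤ (ℕ.≤-pred (subst (ℕ._≤ suc n) len short))

    repeated-vertex : ∀ n {u ds} → Repeat src ds → length ds ℕ.≤ suc n → Walk u ds u → ∑ ds j ≡ 0ℤ
    repeated-vertex n (repeat xs a ys b zs same) = split-vertex n xs a ys b zs same

    repeated-edge : ∀ n {u ds} → Repeat edge ds → length ds ℕ.≤ suc n → Walk u ds u → ∑ ds j ≡ 0ℤ
    repeated-edge n (repeat xs a ys b zs same) with same-edge b a (sym same)
    ... | inj₁ refl = split-vertex n xs a ys b zs refl
    ... | inj₂ refl = split-spur n xs a ys zs

    closed-walk-zero n       []        short walk = refl
    closed-walk-zero (suc n) (d ∷ ds) short walk@(refl , _)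
      with unique-or-repeat Fin._≟_ src (d ∷ ds) | unique-or-repeat Fin._≟_ edge (d ∷ ds)
    ... | inj₂ again         | _              = repeated-vertex n again short walk
    -- With distinct sources, this is a walk along an edge and straight back.
    ... | inj₁ _             | inj₂ again     = repeated-edge n again short walk
    ... | inj₁ vertices-once | inj₁ edges-once = j-cycle record
      { first = d ; rest = ds ; closed = walk ; vertices-once = vertices-once ; edges-once = edges-once }

    -- `P` sums `j` along a chosen walk from the base. Extending the walk to `src d` by `d` and the
    -- walk to `tgt d` by nothing, then returning along the same `back`, gives two closed walks;
    -- comparing them isolates `j d`.
    exact : (∀ u w → ∃[ ds ] Walk u ds w) → Fin v → ∃[ P ] ∀ d → j d ≡ P (tgt d) - P (src d)
    exact connected base = P , λ d →
      let to-src , walk₁ = connected base (src d)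
          to-tgt , walk₂ = connected base (tgt d)
          back   , walk₃ = connected (tgt d) base
          long  = trans (sym (∑-++ j to-src (d ∷ back)))
              (closed-walk-zero _ (to-src ++ d ∷ back) ℕ.≤-refl
              (Walk-++⁺ to-src walk₁ (refl , walk₃)))
          short = trans (sym (∑-++ j to-tgt back))
              (closed-walk-zero _ (to-tgt ++ back) ℕ.≤-refl
              (Walk-++⁺ to-tgt walk₂ walk₃))
      in begin
        j d
          ≡⟨ regroup (P (src d)) (j d) (∑ back j) (P (tgt d)) ⟩
        P (src d) + (j d + ∑ back j) - (P (tgt d) + ∑ back j) + (P (tgt d) - P (src d))
          ≡⟨ cong₂ (λ a b → a - b + (P (tgt d) - P (src d))) long short ⟩
        0ℤ + (P (tgt d) - P (src d))
          ≡⟨ ℤ.+-identityˡ _ ⟩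
        P (tgt d) - P (src d) ∎
      where
      P : Fin v → ℤ
      P x = ∑ (proj₁ (connected base x)) j
      regroup : ∀ a b c d → b ≡ a + (b + c) - (d + c) + (d - a)
      regroup = solve-∀

  -- Edge weights from two balanced orientations

  balanced⇒∂ : ToroidalTriangulation G → ∀ {D D′} → IsBalanced4Orientation G D → IsBalanced4Orientation G D′ →
               ∃[ m ] ∀ c → diff D D′ c ≡ ∂ m c
  balanced⇒∂ triangulation {D} {D′} ((four , one) , γ-zero) ((four′ , one′) , γ-zero′) =
    m , λ c → trans (potential-σ⁺ at-zero c) (trans (shift c) (cong₂ _-_ (M-edge (σ⁺ c)) (M-edge c)))
    where
    open ToroidalTriangulation triangulation using (nonempty; connected)

    at-zero : ∀ x → ∑-at (diff D D′) x ≡ 0ℤ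
    at-zero x = trans (sym (outdegree-src-diff D D′ x)) (cong₂ (λ a b → pos a - pos b) (four x) (four′ x))

    around-zero : ∀ g → ∑-around (diff D D′) g ≡ 0ℤ
    around-zero g = trans (sym (outdegree-left-diff D D′ g)) (cong₂ (λ a b → pos a - pos b) (one′ g) (one g))

    p : Dart → ℤ
    p = potential at-zero

    j : Dart → ℤ
    j d = p d - p (reverse d)

    j-reverse : ∀ d → j (reverse d) ≡ - j d
    j-reverse d = trans (cong (λ c → p (reverse d) - p c) (reverse-involutive d)) (sym (neg-- (p d) (p (reverse d))))

    j-cycle : ∀ C → ∑ (Cycle.steps C) j ≡ 0ℤ
    -- Deciding whether the sum is zero avoids deciding contractibility: a nonzero sum rules out a
    -- contractible cycle, and then both values of `γ` are zero.
    j-cycle C with ∑ (Cycle.steps C) j ℤ.≟ 0ℤ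
    ... | yes eq = eq
    ... | no  ne = ℤ.*-cancelˡ-≡ (pos 2) _ 0ℤ (trans (sym (γ-diff {p = p} (potential-σ⁺ at-zero) C))
      (cong₂ _-_ (γ-zero C ¬contractible) (γ-zero′ C ¬contractible)))
      where
      ¬contractible : ¬ Contractible G C
      ¬contractible disk = ne (contractible-zero C {p = p} (potential-σ⁺ at-zero) around-zero disk)

    vertex-potential : ∃[ P ] ∀ d → j d ≡ P (tgt d) - P (src d)
    vertex-potential = exact j-reverse j-cycle connected (fromℕ< nonempty)

    P : Fin v → ℤ
    P = proj₁ vertex-potential

    -- Adding a function of the source leaves differences around a vertex unchanged; the choice of
    -- `P` makes the values on opposite darts agree, so that `M` descends to edges.
    M : Dart → ℤ
    M c = p c + P (src c)

    m : Fin e → ℤ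
    m x = M (x , true)

    M-reverse : ∀ c → M (reverse c) ≡ M c
    M-reverse c = begin
      p (reverse c) + P (tgt c)
        ≡⟨ regroup (p (reverse c)) (P (tgt c)) (P (src c)) ⟩
      p (reverse c) + (P (tgt c) - P (src c)) + P (src c)
        ≡⟨ cong (λ k → p (reverse c) + k + P (src c)) (proj₂ vertex-potential c) ⟨
      p (reverse c) + (p c - p (reverse c)) + P (src c)
        ≡⟨ cong (_+ P (src c)) (cancel (p (reverse c)) (p c)) ⟩
      M c ∎
      where
      regroup : ∀ a b c → a + b ≡ a + (b - c) + c
      regroup = solve-∀
      cancel : ∀ a b → a + (b - a) ≡ b
      cancel = solve-∀

    M-edge : ∀ c → M c ≡ m (edge c)
    M-edge (x , true)  = refl
    M-edge (x , false) = M-reverse (x , true)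

    shift : ∀ c → p (σ⁺ c) - p c ≡ M (σ⁺ c) - M c
    shift c = trans (regroup (p (σ⁺ c)) (p c) (P (src c)))
      (cong (λ x → p (σ⁺ c) + P x - M c) (sym (src-σ⁺ c)))
      where
      regroup : ∀ a b k → a - b ≡ a + k - (b + k)
      regroup = solve-∀

lemma16 : ∀ {v e f : ℕ} (G : FiniteMap v e f) →
    ToroidalTriangulation G → EssentiallyFourConnected G →
    ∀ (R D D′ : AngleOrientation e) → IsBalanced4Orientation G D →
    IsBalanced4Orientation G D′ ⇔ AngleHomology.Homologous G R D D′
lemma16 G triangulation _ R D D′ balanced = mk⇔
  (λ balanced′ → let m , eq = balanced⇒∂ triangulation balanced balanced′ in ∂⇒homologous {D} {D′} m eq)
  (λ homologous → let m , eq = homologous⇒∂ {D} {D′} homologous in ∂⇒balanced m eq balanced)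
  where
  open FacialFlows G R
  open Balance G
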